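{- Every $2$-saturated subcubic graph $G$ such that $g_3(G)=3$ is $(1,2,2,2)$-packing colorable.
   Context: All graphs are finite, simple and undirected. For a non-decreasing sequence $S=(s_1,\dots,s_k)$ of positive integers, an $S$-packing coloring of $G$ is a partition of $V(G)$ into sets $V_1,\dots,V_k$ such that any two distinct vertices $u,v\in V_i$ satisfy $dist_G(u,v)>s_i$; $G$ is $S$-packing colorable if it admits one. $G$ is subcubic if its maximum degree is at most $3$. A subcubic graph is $k$-saturated if every vertex of degree $3$ is adjacent to at most $k$ vertices of degree $3$. The local girth $g(v)$ of a vertex $v$ is the length of a shortest cycle containing $v$ ($\infty$ if none), and $g_3(G)=\max\{g(v): d_G(v)=3\}$. -}

module Defs where

open import Data.Nat using (ℕ; zero; suc; _≤_; _<_)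
open import Data.Fin using (Fin; zero; suc; inject₁; fromℕ)
open import Data.Vec using (Vec; lookup; _∷_; [])
open import Data.List using (List; length; filter; allFin)
open import Data.Product using (Σ; ∃; _×_; _,_)
open import Relation.Nullary using (¬_; Dec; _×-dec_)
open import Data.Empty using (⊥)
open import Data.Nat using (_≟_)
open import Relation.Binary.PropositionalEquality using (_≡_; _≢_)
open import Function.Definitions using (Injective)

record Graph (n : ℕ) : Set₁ where
  field
    Adj    : Fin n → Fin n → Set
    adj?   : ∀ u v → Dec (Adj u v)
    sym    : ∀ {u v} → Adj u v → Adj v u
    irrefl : ∀ {u} → ¬ Adj u u

module _ {n : ℕ} (G : Graph n) where
  open Graph G

  deg : Fin n → ℕ
  deg v = length (filter (adj? v) (allFin n))

  deg3Neighbours : Fin n → ℕ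
  deg3Neighbours v = length (filter (λ w → adj? v w ×-dec (deg w ≟ 3)) (allFin n))

  Subcubic : Set
  Subcubic = ∀ v → deg v ≤ 3

  Saturated : ℕ → Set
  Saturated k = ∀ v → deg v ≡ 3 → deg3Neighbours v ≤ k

  data Walk : Fin n → Fin n → ℕ → Set where
    here : ∀ {u} → Walk u u 0
    step : ∀ {u w v k} → Adj u w → Walk w v k → Walk u v (suc k)

  Dist : Fin n → Fin n → ℕ → Set
  Dist u v d = Walk u v d × (∀ k → k < d → ¬ Walk u v k)

  -- dist(u,v) > s  (vacuous when u,v are in different components: dist = ∞)
  DistGt : Fin n → Fin n → ℕ → Set
  DistGt u v s = ∀ d → Dist u v d → s < d

  CycleThrough : Fin n → ℕ → Set
  CycleThrough v zero = ⊥
  CycleThrough v (suc m) =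
    2 ≤ m × Σ (Fin (suc m) → Fin n) λ c →
      Injective _≡_ _≡_ c × c zero ≡ v ×
      (∀ (i : Fin m) → Adj (c (inject₁ i)) (c (suc i))) ×
      Adj (c (fromℕ m)) (c zero)

  LocalGirth : Fin n → ℕ → Set
  LocalGirth v k = CycleThrough v k × (∀ j → j < k → ¬ CycleThrough v j)

  -- g₃(G) = m : the maximum of g(v) over degree-3 vertices equals m
  -- (in particular there is a degree-3 vertex and all such g(v) are finite)
  G3 : ℕ → Set
  G3 m = (∀ v → deg v ≡ 3 → ∃ λ k → LocalGirth v k × k ≤ m)
       × (∃ λ v → deg v ≡ 3 × LocalGirth v m)

  PackingColorable : ∀ {k} → Vec ℕ k → Set
  PackingColorable {k} S = Σ (Fin n → Fin k) λ c →
    ∀ u v → u ≢ v → c u ≡ c v → DistGt u v (lookup S (c u))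

{-# OPTIONS --safe #-}
module Submission where

open import Defs
open import Data.Empty using (⊥; ⊥-elim)
open import Data.Fin using (Fin; _≟_)
open import Data.Fin.Patterns using (0F; 1F; 2F; 3F; 4F; 5F)
open import Data.Fin.Properties using (any?; all?)
open import Data.List using (List; []; _∷_; _++_; map; length; filter; allFin)
open import Data.List.Membership.DecPropositional using (_∈?_)
open import Data.List.Membership.Propositional using (_∈_)
open import Data.List.Membership.Propositional.Properties using (∈-map⁻; ∈-allFin; ∈-filter⁺; ∈-filter⁻; ∈-++⁻)
open import Data.List.Properties using (filter-notAll)
open import Data.List.Relation.Unary.All as All using (All; []; _∷_)
open import Data.List.Relation.Unary.All.Properties using (¬Any⇒All¬; All¬⇒¬Any; ++⁺; ++⁻ˡ; ++⁻ʳ)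
open import Data.List.Relation.Unary.AllPairs using (AllPairs; []; _∷_)
open import Data.List.Relation.Unary.Any as Any using (here; there)
open import Data.List.Relation.Unary.Unique.Propositional using (Unique)
open import Data.List.Relation.Unary.Unique.Propositional.Properties using (allFin⁺; filter⁺)
open import Data.Nat as ℕ using (ℕ; suc; _≤_; _<_; z≤n; s≤s)
open import Data.Nat.Induction using (<-wellFounded)
open import Data.Nat.Properties using (≤-trans; ≤-antisym; <⇒≱)
open import Data.Product using (∃; _×_; _,_; proj₁; proj₂)
open import Data.Sum using (_⊎_; inj₁; inj₂; [_,_]′)
open import Data.Vec as Vec using (Vec; _∷_; [])
open import Data.Vec.Properties using (lookup∘tabulate)
open import Function using (id)
open import Induction.WellFounded using (Acc; acc)
open import Relation.Binary.PropositionalEquality using (_≡_; _≢_; refl; sym; trans; cong; subst; ≢-sym)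
open import Relation.Nullary using (¬_; Dec; yes; no; ¬?; _×-dec_; _→-dec_)
open import Relation.Nullary.Decidable using (toWitness; decidable-stable; map′)

-- A minimal counterexample is shown to have no edges.  It suffices to derive ⊥ from it, since the
-- existence of a colouring of a finite graph is decidable.  The induction carries the extra requirement
-- that a leaf gets colour 0 (the class of radius 1) unless its neighbour is a leaf too: deleting a few
-- vertices turns their outer neighbours of degree 2 into leaves, and a leaf of colour 0 only forbids,
-- besides 0, the colour of its remaining neighbour.
--
-- Pendant paths, twins, diamonds and leaves on triangles are reducible.  Then every vertex of degree 3
-- lies in exactly one triangle, which is either a hat (two vertices of degree 3) or has three vertices
-- of degree 3, whose outer neighbours have degree 2 by saturation.  A hat next to a vertex of degree 2
-- is reducible, and so is a hat between two hats, as twins may exchange their colours.  Now all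
-- triangles are of the second kind and are joined by paths with one or two interior vertices.  Two
-- paths of the second sort at a triangle are reducible; otherwise two triangles are joined by a path
-- u - o - t and both are deleted together: colouring them without 0, and o with 0, fails only if the
-- outer conditions all forbid the same colour, which then can be given to o, with 0 on u and t.

-- The obstacle is what an outer neighbour `c` of a deleted vertex forbids: its own colour and those
-- of its two other neighbours may be all three nonzero colours. Two devices reduce this. A
-- colouring may be taken `Maximal`, with a 0 next to every nonzero vertex; then at most two nonzero
-- colours are forbidden and `spare` finds a third. And where the leaf condition applies, `c` has
-- colour 0: it forbids only the colour of one further vertex and does not restrict the other
-- deleted vertices. Three vertices with one forbidden colour each can share out the nonzero colours
-- unless all three forbid the same one (`rainbow!`).
--
-- The leaf condition needs its exception because the ends of an isolated edge cannot both have
-- colour 0. The price is that configurations whose deletion may leave such an edge between outer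
-- neighbours need an argument of their own, as in `noLoop` and `noCross`.

Colour : Set
Colour = Fin 4

-- Only colour 0, which stands for the packing radius 1, may be repeated in a neighbourhood.
Compatible : Colour → Colour → Set
Compatible k l = k ≡ l → k ≡ 0F

compatible? : ∀ k l → Dec (Compatible k l)
compatible? k l = (k ≟ l) →-dec (k ≟ 0F)

Compatible-sym : ∀ {k l} → Compatible k l → Compatible l k
Compatible-sym c refl = c refl

≢⇒Compatible : ∀ {k l} → k ≢ l → Compatible k l
≢⇒Compatible k≢l k≡l = ⊥-elim (k≢l k≡l)

0-compatible : ∀ {k l} → k ≡ 0F → Compatible k l
0-compatible k≡0 _ = k≡0

compatible-0 : ∀ {k l} → l ≡ 0F → Compatible k l
compatible-0 l≡0 k≡l = trans k≡l l≡0

abstract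
  avoid₂ : ∀ x y → ∃ λ (k : Colour) → k ≢ 0F × k ≢ x × k ≢ y
  avoid₂ = toWitness {a? = all? λ x → all? λ y → any? λ k →
    ¬? (k ≟ 0F) ×-dec ¬? (k ≟ x) ×-dec ¬? (k ≟ y)} _

record Rainbow (x y z : Colour) : Set where
  constructor rainbow
  field
    α β γ : Colour
    α≢0   : α ≢ 0F
    β≢0   : β ≢ 0F
    γ≢0   : γ ≢ 0F
    α≢β   : α ≢ β
    α≢γ   : α ≢ γ
    β≢γ   : β ≢ γ
    α≢x   : α ≢ x
    β≢y   : β ≢ y
    γ≢z   : γ ≢ z

-- Forbidding 0 adds nothing to nonzero entries, so this is the type of permutations of the three
-- nonzero colours.
Arrangement : Set
Arrangement = Rainbow 0F 0F 0F

arrangement : Fin 6 → Arrangement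
arrangement 0F = rainbow 1F 2F 3F (λ ()) (λ ()) (λ ()) (λ ()) (λ ()) (λ ()) (λ ()) (λ ()) (λ ())
arrangement 1F = rainbow 1F 3F 2F (λ ()) (λ ()) (λ ()) (λ ()) (λ ()) (λ ()) (λ ()) (λ ()) (λ ())
arrangement 2F = rainbow 2F 1F 3F (λ ()) (λ ()) (λ ()) (λ ()) (λ ()) (λ ()) (λ ()) (λ ()) (λ ())
arrangement 3F = rainbow 2F 3F 1F (λ ()) (λ ()) (λ ()) (λ ()) (λ ()) (λ ()) (λ ()) (λ ()) (λ ())
arrangement 4F = rainbow 3F 1F 2F (λ ()) (λ ()) (λ ()) (λ ()) (λ ()) (λ ()) (λ ()) (λ ()) (λ ())
arrangement 5F = rainbow 3F 2F 1F (λ ()) (λ ()) (λ ()) (λ ()) (λ ()) (λ ()) (λ ()) (λ ()) (λ ())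

Fits : Colour → Colour → Colour → Arrangement → Set
Fits x y z a = Rainbow.α a ≢ x × Rainbow.β a ≢ y × Rainbow.γ a ≢ z

fits? : ∀ x y z → Dec (∃ λ i → Fits x y z (arrangement i))
fits? x y z = any? λ i → ¬? (_ ≟ x) ×-dec ¬? (_ ≟ y) ×-dec ¬? (_ ≟ z)

abstract
  -- A colour forbidden at all three places could not be used at all; otherwise Hall's condition
  -- holds for the three nonzero colours. All triples are checked by evaluation.
  arrange : ∀ x y z → ¬ (x ≡ y × y ≡ z) → ∃ λ i → Fits x y z (arrangement i)
  arrange = toWitness {a? = all? λ x → all? λ y → all? λ z →
    ¬? ((x ≟ y) ×-dec (y ≟ z)) →-dec fits? x y z} _

rainbow! : ∀ x y z → ¬ (x ≡ y × y ≡ z) → Rainbow x y z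
rainbow! x y z h with arrange x y z h
... | i , fits with arrangement i | fits
... | rainbow α β γ p q r s t u _ _ _ | a , b , c = rainbow α β γ p q r s t u a b c

-- Deletion of vertices, and extension of colourings

module _ {n : ℕ} where

  Fresh : Fin n → List (Fin n) → Set
  Fresh v X = All (v ≢_) X

  fresh? : ∀ v X → v ∈ X ⊎ Fresh v X
  fresh? v X with _∈?_ _≟_ v X
  ... | yes v∈X = inj₁ v∈X
  ... | no v∉X = inj₂ (¬Any⇒All¬ X v∉X)

  clash : ∀ {v X} {A : Set} → v ∈ X → Fresh v X → A
  clash v∈X v∉X = ⊥-elim (All¬⇒¬Any v∉X v∈X)

  -- Deleted vertices stay in the vertex set, but become isolated.
  _∖_ : Graph n → List (Fin n) → Graph n
  Graph.Adj (G ∖ X) v w = Graph.Adj G v w × Fresh v X × Fresh w X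
  Graph.adj? (G ∖ X) v w = Graph.adj? G v w ×-dec fr v ×-dec fr w
    where
    fr : ∀ v → Dec (Fresh v X)
    fr v = All.all? (λ x → ¬? (v ≟ x)) X
  Graph.sym (G ∖ X) (a , p , q) = Graph.sym G a , q , p
  Graph.irrefl (G ∖ X) (a , _) = Graph.irrefl G a

  infixl 5 _∖_

  _⊑_ : Graph n → Graph n → Set
  H ⊑ G = ∀ {v w} → Graph.Adj H v w → Graph.Adj G v w

  -- For colouring in stages: a colouring after deleting `X ++ Y` is extended to `Y` while `X` is
  -- still missing, and to `X` afterwards.
  ∖∖⊑ : ∀ {G X Y} → ((G ∖ X) ∖ Y) ⊑ (G ∖ (X ++ Y))
  ∖∖⊑ ((a , p , q) , r , s) = a , ++⁺ p r , ++⁺ q s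

  module _ (G : Graph n) where
    open Graph G renaming (sym to symm)

    -- An isolated vertex counts as a leaf; having no neighbour to excuse it, it must get colour 0
    -- under `LeafyAt`.
    Leaf : Fin n → Set
    Leaf x = ∀ {v w} → Adj x v → Adj x w → v ≡ w

    -- Vertices at distance two have a common neighbour, so a packing colouring with radii 1, 2, 2,
    -- 2 is a condition on edges and on pairs of neighbours of one vertex.
    record Valid (f : Fin n → Colour) : Set where
      field
        proper : ∀ {v w} → Adj v w → f v ≢ f w
        apart  : ∀ {v w w′} → Adj v w → Adj v w′ → w ≢ w′ → Compatible (f w) (f w′)

    LeafyAt : (Fin n → Colour) → Fin n → Set
    LeafyAt f x = Leaf x → f x ≡ 0F ⊎ ∃ λ y → Adj x y × Leaf y

    Leafy : (Fin n → Colour) → Set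
    Leafy f = ∀ {x} → LeafyAt f x

    Maximal : (Fin n → Colour) → Set
    Maximal f = ∀ {x} → f x ≢ 0F → ∃ λ w → Adj x w × f w ≡ 0F

    record Nice (f : Fin n → Colour) : Set where
      field
        valid   : Valid f
        leafy   : Leafy f
        maximal : Maximal f
      open Valid valid public

    Good : Set
    Good = ∃ λ f → Valid f × Leafy f

    -- Giving colour k to a new neighbour of v creates no conflict at v.
    Free : (Fin n → Colour) → Fin n → Colour → Set
    Free f v k = k ≢ f v × (∀ {w} → Adj v w → Compatible k (f w))

  Valid-⊑ : ∀ {G H f} → H ⊑ G → Valid G f → Valid H f
  Valid-⊑ s V = record
    { proper = λ a → Valid.proper V (s a)
    ; apart  = λ a b → Valid.apart V (s a) (s b) }

  Free-cong : ∀ {G f g v k} → f v ≡ g v → (∀ {w} → Graph.Adj G v w → f w ≡ g w) → Free G f v k → Free G g v k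
  Free-cong e h (p , q) = (λ k≡ → p (trans k≡ (sym e))) , λ a k≡ → q a (trans k≡ (sym (h a)))

  Free-0 : ∀ {G f v k} → k ≡ 0F → f v ≢ 0F → Free G f v k
  Free-0 refl f≢0 = (λ e → f≢0 (sym e)) , λ _ _ → refl

  -- Extending a colouring of G ∖ X

  -- Distinct colours on `X` leave only conflicts with a vertex outside. Such a conflict lies on an
  -- edge or has its middle vertex outside `X` (both covered by `Free`) or has its middle vertex in
  -- `X` (the second condition). The last condition keeps two old vertices from being joined by a
  -- new path through `X`.
  extend : ∀ {G} X {f f′ : Fin n → Colour} → Valid (G ∖ X) f′ →
    (∀ {z} → Fresh z X → f z ≡ f′ z) →
    (∀ {x y} → x ∈ X → y ∈ X → x ≢ y → f x ≢ f y) →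
    (∀ {x z} → x ∈ X → Graph.Adj G x z → Fresh z X →
      Free (G ∖ X) f′ z (f x) ×
      (∀ {y} → y ∈ X → Graph.Adj G x y → Compatible (f′ z) (f y)) ×
      (∀ {z′} → Graph.Adj G x z′ → Fresh z′ X → z ≡ z′)) →
    Valid G f
  extend {G} X {f} {f′} V agree distinct outer = record { proper = proper ; apart = apart }
    where
    open Graph G renaming (sym to symm)
    module V = Valid V
    proper : ∀ {v w} → Adj v w → f v ≢ f w
    proper {v} {w} a e with fresh? v X | fresh? w X
    ... | inj₁ v∈ | inj₁ w∈ = distinct v∈ w∈ (λ { refl → irrefl a }) e
    ... | inj₁ v∈ | inj₂ w∉ = proj₁ (proj₁ (outer v∈ a w∉)) (trans e (agree w∉))
    ... | inj₂ v∉ | inj₁ w∈ = proj₁ (proj₁ (outer w∈ (symm a) v∉)) (trans (sym e) (agree v∉))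
    ... | inj₂ v∉ | inj₂ w∉ = V.proper (a , v∉ , w∉) (trans (sym (agree v∉)) (trans e (agree w∉)))
    half : ∀ {v w w′} → Adj v w → Adj v w′ → w ≢ w′ → w ∈ X → Fresh w′ X → Compatible (f w) (f w′)
    half {v} a b w≢w′ w∈ w′∉ with fresh? v X
    ... | inj₁ v∈ = Compatible-sym (subst (λ k → Compatible k _) (sym (agree w′∉))
                      (proj₁ (proj₂ (outer v∈ b w′∉)) w∈ a))
    ... | inj₂ v∉ = subst (Compatible _) (sym (agree w′∉))
                      (proj₂ (proj₁ (outer w∈ (symm a) v∉)) (b , v∉ , w′∉))
    apart : ∀ {v w w′} → Adj v w → Adj v w′ → w ≢ w′ → Compatible (f w) (f w′)
    apart {v} {w} {w′} a b w≢w′ with fresh? w X | fresh? w′ X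
    ... | inj₁ w∈ | inj₁ w′∈ = ≢⇒Compatible (distinct w∈ w′∈ w≢w′)
    ... | inj₁ w∈ | inj₂ w′∉ = half a b w≢w′ w∈ w′∉
    ... | inj₂ w∉ | inj₁ w′∈ = Compatible-sym (half b a (≢-sym w≢w′) w′∈ w∉)
    ... | inj₂ w∉ | inj₂ w′∉ with fresh? v X
    ...   | inj₁ v∈ = ⊥-elim (w≢w′ (proj₂ (proj₂ (outer v∈ a w∉)) b w′∉))
    ...   | inj₂ v∉ rewrite agree w∉ | agree w′∉ = V.apart (a , v∉ , w∉) (b , v∉ , w′∉) w≢w′

  -- `out` is the only neighbour that `vert` may have outside the painted set. All conditions on it
  -- presuppose adjacency, so `vert` itself serves as a dummy when there is none.
  record Item : Set where
    constructor ⟨_,_,_⟩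
    field
      vert   : Fin n
      colour : Colour
      out    : Fin n
  open Item

  verts : List Item → List (Fin n)
  verts = map vert

  paint : List Item → (Fin n → Colour) → Fin n → Colour
  paint [] f z = f z
  paint (i ∷ is) f z with z ≟ vert i
  ... | yes _ = colour i
  ... | no _  = paint is f z

  paint-fresh : ∀ is {f z} → Fresh z (verts is) → paint is f z ≡ f z
  paint-fresh [] [] = refl
  paint-fresh (i ∷ is) {z = z} (p ∷ ps) with z ≟ vert i
  ... | yes e = ⊥-elim (p e)
  ... | no _  = paint-fresh is ps

  Painting : Graph n → List Item → (Fin n → Colour) → Set
  Painting G is f′ = ∃ λ f → Valid G f × All (λ i → f (vert i) ≡ colour i) is ×
    (∀ {z} → Fresh z (verts is) → f z ≡ f′ z)

  module _ (G : Graph n) (f′ : Fin n → Colour) (is : List Item) where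
    open Graph G using (Adj; irrefl)

    -- The outer neighbour of one item has to be compatible with every other item, adjacent or not.
    -- This is exact for cliques, the only sets painted in one go; all others are painted in stages.
    Separate : Item → Item → Set
    Separate i j = vert i ≢ vert j × colour i ≢ colour j
      × (Adj (vert i) (out i) → Compatible (f′ (out i)) (colour j))
      × (Adj (vert j) (out j) → Compatible (f′ (out j)) (colour i))

    Covered : Item → Set
    Covered i = ∀ {z} → Adj (vert i) z → z ∈ verts is ⊎ z ≡ out i

    OutFree : Item → Set
    OutFree i = Adj (vert i) (out i) → Free (G ∖ verts is) f′ (out i) (colour i)

  module _ {G : Graph n} {f′ : Fin n → Colour} {is₀ : List Item} where
    paint-colour : ∀ {is} → AllPairs (Separate G f′ is₀) is →
      All (λ i → paint is f′ (vert i) ≡ colour i) is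
    paint-colour [] = []
    paint-colour {i ∷ is} (ps ∷ pps) = hd ∷ All.zipWith tl (ps , paint-colour pps)
      where
      hd : paint (i ∷ is) f′ (vert i) ≡ colour i
      hd with vert i ≟ vert i
      ... | yes _ = refl
      ... | no ¬e = ⊥-elim (¬e refl)
      tl : ∀ {j} → Separate G f′ is₀ i j × paint is f′ (vert j) ≡ colour j →
        paint (i ∷ is) f′ (vert j) ≡ colour j
      tl {j} (s , e) with vert j ≟ vert i
      ... | yes e′ = ⊥-elim (proj₁ s (sym e′))
      ... | no _   = e

    separate : ∀ {is i j} → AllPairs (Separate G f′ is₀) is → i ∈ is → j ∈ is →
      vert i ≢ vert j → Separate G f′ is₀ i j
    separate (ps ∷ _) (here refl) (here refl) ne = ⊥-elim (ne refl)
    separate (ps ∷ _) (here refl) (there j∈) ne = All.lookup ps j∈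
    separate (ps ∷ _) (there i∈) (here refl) ne with All.lookup ps i∈
    ... | a , b , c , d = ≢-sym a , ≢-sym b , d , c
    separate (_ ∷ pps) (there i∈) (there j∈) ne = separate pps i∈ j∈ ne

  extend-paint : ∀ {G f′} is → Valid (G ∖ verts is) f′ →
    AllPairs (Separate G f′ is) is → All (Covered G f′ is) is → All (OutFree G f′ is) is →
    Painting G is f′
  extend-paint {G} {f′} is V S C O =
    f , extend (verts is) V (paint-fresh is) distinct outer , colours , paint-fresh is
    where
    open Graph G using (Adj; irrefl)
    f = paint is f′
    colours = paint-colour {G} {f′} {is} S
    distinct : ∀ {x y} → x ∈ verts is → y ∈ verts is → x ≢ y → f x ≢ f y
    distinct x∈ y∈ ne e with ∈-map⁻ vert x∈ | ∈-map⁻ vert y∈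
    ... | i , i∈ , refl | j , j∈ , refl =
      proj₁ (proj₂ (separate {G} {f′} {is} S i∈ j∈ ne))
        (trans (sym (All.lookup colours i∈)) (trans e (All.lookup colours j∈)))
    isOut : ∀ {i z} → i ∈ is → Adj (vert i) z → Fresh z (verts is) → z ≡ out i
    isOut i∈ a z∉ with All.lookup C i∈ a
    ... | inj₁ z∈ = clash z∈ z∉
    ... | inj₂ e  = e
    outer : ∀ {x z} → x ∈ verts is → Adj x z → Fresh z (verts is) →
      Free (G ∖ verts is) f′ z (f x) ×
      (∀ {y} → y ∈ verts is → Adj x y → Compatible (f′ z) (f y)) ×
      (∀ {z′} → Adj x z′ → Fresh z′ (verts is) → z ≡ z′)
    outer x∈ a z∉ with ∈-map⁻ vert x∈
    ... | i , i∈ , refl with isOut i∈ a z∉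
    ... | refl =
      subst (Free (G ∖ verts is) f′ _) (sym (All.lookup colours i∈)) (All.lookup O i∈ a) ,
      toAll , λ b z′∉ → sym (isOut i∈ b z′∉)
      where
      toAll : ∀ {y} → y ∈ verts is → Adj (vert i) y → Compatible (f′ (out i)) (f y)
      toAll y∈ b with ∈-map⁻ vert y∈
      ... | j , j∈ , refl = subst (Compatible _) (sym (All.lookup colours j∈))
        (proj₁ (proj₂ (proj₂ (separate {G} {f′} {is} S i∈ j∈ λ e → irrefl (subst (Adj _) (sym e) b)))) a)

-- Degrees, the hereditary class, and maximal colourings

module _ {n : ℕ} where

  module _ (G : Graph n) where
    open Graph G using (Adj)

    record N₁ (v a : Fin n) : Set where
      constructor n₁
      field
        va    : Adj v a
        cover : ∀ {w} → Adj v w → w ≡ a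

    record N₂ (v a b : Fin n) : Set where
      constructor n₂
      field
        va    : Adj v a
        vb    : Adj v b
        a≢b   : a ≢ b
        cover : ∀ {w} → Adj v w → w ≡ a ⊎ w ≡ b

    -- Unlike `N₁` and `N₂` it has no covering clause, so that it passes to supergraphs; `subcubic`
    -- supplies the covering.
    record N₃ (v a b c : Fin n) : Set where
      constructor n₃
      field
        va  : Adj v a
        vb  : Adj v b
        vc  : Adj v c
        a≢b : a ≢ b
        a≢c : a ≢ c
        b≢c : b ≢ c

    Three : Fin n → Set
    Three v = ∃ λ a → ∃ λ b → ∃ λ c → N₃ v a b c

    data Degree (v : Fin n) : Set where
      deg₀ : (∀ {w} → ¬ Adj v w) → Degree v
      deg₁ : ∀ {a} → N₁ v a → Degree v
      deg₂ : ∀ {a b} → N₂ v a b → Degree v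
      deg₃ : ∀ {a b c} → N₃ v a b c → Degree v

    -- The hypotheses on the graph in a form that survives deletion: each speaks only of a vertex
    -- with three given neighbours.
    record Class : Set where
      field
        subcubic  : ∀ {v a b c d} → N₃ v a b c → Adj v d → d ≡ a ⊎ d ≡ b ⊎ d ≡ c
        triangle  : ∀ {v a b c} → N₃ v a b c → Adj a b ⊎ Adj a c ⊎ Adj b c
        saturated : ∀ {v a b c} → N₃ v a b c → Three a → Three b → Three c → ⊥

  module _ {G : Graph n} where
    open Graph G renaming (sym to symm)

    swap₂ : ∀ {v a b} → N₂ G v a b → N₂ G v b a
    swap₂ (n₂ p q d c) = n₂ q p (≢-sym d) λ e → [ inj₂ , inj₁ ]′ (c e)

    swap₃ : ∀ {v a b c} → N₃ G v a b c → N₃ G v b a c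
    swap₃ (n₃ p q r x y z) = n₃ q p r (≢-sym x) z y

    rotate₃ : ∀ {v a b c} → N₃ G v a b c → N₃ G v b c a
    rotate₃ (n₃ p q r x y z) = n₃ q r p z (≢-sym x) (≢-sym y)

    ≢-adj : ∀ {v w} → Adj v w → v ≢ w
    ≢-adj a refl = irrefl a

    two≢three : ∀ {v a b} {A : Set} → N₂ G v a b → Three G v → A
    two≢three (n₂ _ _ _ cov) (_ , _ , _ , n₃ p q r x y z) with cov p | cov q | cov r
    ... | inj₁ refl | inj₁ refl | _ = ⊥-elim (x refl)
    ... | inj₂ refl | inj₂ refl | _ = ⊥-elim (x refl)
    ... | inj₁ refl | _ | inj₁ refl = ⊥-elim (y refl)
    ... | inj₂ refl | _ | inj₂ refl = ⊥-elim (y refl)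
    ... | _ | inj₁ refl | inj₁ refl = ⊥-elim (z refl)
    ... | _ | inj₂ refl | inj₂ refl = ⊥-elim (z refl)

    degree : ∀ v → Degree G v
    degree v = go (filter (adj? v) (allFin n)) (filter⁺ (adj? v) (allFin⁺ n))
      (λ a → ∈-filter⁺ (adj? v) (∈-allFin _) a) (λ m → proj₂ (∈-filter⁻ (adj? v) {xs = allFin n} m))
      where
      go : ∀ xs → Unique xs → (∀ {w} → Adj v w → w ∈ xs) → (∀ {w} → w ∈ xs → Adj v w) → Degree G v
      go [] _ c _ = deg₀ λ a → case0 (c a)
        where
        case0 : ∀ {w} → ¬ (w ∈ [])
        case0 ()
      go (a ∷ []) _ c m = deg₁ (n₁ (m (here refl)) λ e → case1 (c e))
        where
        case1 : ∀ {w} → w ∈ a ∷ [] → w ≡ a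
        case1 (here e) = e
      go (a ∷ b ∷ []) ((d ∷ _) ∷ _) c m = deg₂ (n₂ (m (here refl)) (m (there (here refl))) d λ e → case2 (c e))
        where
        case2 : ∀ {w} → w ∈ a ∷ b ∷ [] → w ≡ a ⊎ w ≡ b
        case2 (here e) = inj₁ e
        case2 (there (here e)) = inj₂ e
      go (a ∷ b ∷ c ∷ _) ((x ∷ y ∷ _) ∷ (z ∷ _) ∷ _) _ m =
        deg₃ (n₃ (m (here refl)) (m (there (here refl))) (m (there (there (here refl)))) x y z)

    from₂ : ∀ {v a b} → Adj v a → Adj v b → a ≢ b → N₂ G v a b ⊎ ∃ λ c → N₃ G v a b c
    from₂ {v} {a} {b} p q d with degree v
    ... | deg₀ h = ⊥-elim (h p)
    ... | deg₁ (n₁ _ cov) = ⊥-elim (d (trans (cov p) (sym (cov q))))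
    ... | deg₂ (n₂ _ _ _ cov) = inj₁ (n₂ p q d cov′)
      where
      cov′ : ∀ {w} → Adj v w → w ≡ a ⊎ w ≡ b
      cov′ e with cov e | cov p | cov q
      ... | inj₁ refl | inj₁ refl | _ = inj₁ refl
      ... | inj₁ refl | inj₂ refl | inj₁ refl = inj₂ refl
      ... | inj₁ refl | inj₂ refl | inj₂ refl = ⊥-elim (d refl)
      ... | inj₂ refl | inj₂ refl | _ = inj₁ refl
      ... | inj₂ refl | inj₁ refl | inj₂ refl = inj₂ refl
      ... | inj₂ refl | inj₁ refl | inj₁ refl = ⊥-elim (d refl)
    ... | deg₃ {x} {y} {z} (n₃ vx vy vz xy xz yz) with x ≟ a | x ≟ b | y ≟ a | y ≟ b
    ...   | no xa | no xb | _ | _ = inj₂ (x , n₃ p q vx d (≢-sym xa) (≢-sym xb))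
    ...   | _ | _ | no ya | no yb = inj₂ (y , n₃ p q vy d (≢-sym ya) (≢-sym yb))
    ...   | yes refl | _ | yes refl | _ = ⊥-elim (xy refl)
    ...   | yes refl | _ | _ | yes refl = inj₂ (z , n₃ p q vz d xz yz)
    ...   | _ | yes refl | yes refl | _ = inj₂ (z , n₃ p q vz d yz xz)
    ...   | _ | yes refl | _ | yes refl = ⊥-elim (xy refl)

    leaf₁ : ∀ {v a} → N₁ G v a → Leaf G v
    leaf₁ (n₁ _ cov) p q = trans (cov p) (sym (cov q))

    ¬leaf : ∀ {v a b} {A : Set} → Adj v a → Adj v b → a ≢ b → Leaf G v → A
    ¬leaf p q d l = ⊥-elim (d (l p q))

    from-leaf : ∀ {v a} → Adj v a → Leaf G v → N₁ G v a
    from-leaf p l = n₁ p λ q → l q p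

    module _ (cls : Class G) where
      open Class cls

      last₃ : ∀ {v y} → Three G v → Adj v y → ∃ λ a → ∃ λ b → N₃ G v a b y
      last₃ (_ , _ , _ , N) q with subcubic N q
      ... | inj₁ refl = _ , _ , rotate₃ N
      ... | inj₂ (inj₁ refl) = _ , _ , rotate₃ (rotate₃ N)
      ... | inj₂ (inj₂ refl) = _ , _ , N

      same₃ : ∀ {v a b c d} → N₃ G v a b c → Adj v d → d ≢ a → d ≢ b → d ≡ c
      same₃ N q x y with subcubic N q
      ... | inj₁ e = ⊥-elim (x e)
      ... | inj₂ (inj₁ e) = ⊥-elim (y e)
      ... | inj₂ (inj₂ e) = e

  -- Three neighbours in the smaller graph are three neighbours in `G`, and an edge between two of
  -- them survives because its ends do.
  Class-∖ : ∀ {G} X → Class G → Class (G ∖ X)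
  Class-∖ {G} X C = record
    { subcubic  = λ N a → C.subcubic (N₃⊑ N) (proj₁ a)
    ; triangle  = λ N → tri N (C.triangle (N₃⊑ N))
    ; saturated = λ N a b c → C.saturated (N₃⊑ N) (Three⊑ a) (Three⊑ b) (Three⊑ c) }
    where
    module C = Class C
    N₃⊑ : ∀ {v a b c} → N₃ (G ∖ X) v a b c → N₃ G v a b c
    N₃⊑ (n₃ p q r x y z) = n₃ (proj₁ p) (proj₁ q) (proj₁ r) x y z
    Three⊑ : ∀ {v} → Three (G ∖ X) v → Three G v
    Three⊑ (_ , _ , _ , N) = _ , _ , _ , N₃⊑ N
    tri : ∀ {v a b c} → N₃ (G ∖ X) v a b c → Graph.Adj G a b ⊎ Graph.Adj G a c ⊎ Graph.Adj G b c →
      Graph.Adj (G ∖ X) a b ⊎ Graph.Adj (G ∖ X) a c ⊎ Graph.Adj (G ∖ X) b c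
    tri (n₃ (_ , _ , p) (_ , _ , q) (_ , _ , r) _ _ _) =
      [ (λ e → inj₁ (e , p , q)) , [ (λ e → inj₂ (inj₁ (e , p , r))) , (λ e → inj₂ (inj₂ (e , q , r))) ]′ ]′

  quiet : ∀ {G : Graph n} {f x} → Nice G f → (∀ {w} → ¬ Graph.Adj G x w) → f x ≡ 0F
  quiet {f = f} {x} N h = decidable-stable (f x ≟ 0F) λ ne → h (proj₁ (proj₂ (Nice.maximal N ne)))

  deleted : ∀ {G f x X} → Nice (G ∖ X) f → x ∈ X → f x ≡ 0F
  deleted N x∈ = quiet N λ (_ , x∉ , _) → clash x∈ x∉

  -- A vertex that lost a neighbour has at most two left, hence a spare nonzero colour.
  spare : ∀ {G f X x e} → Class G → Nice (G ∖ X) f → x ∈ X → Graph.Adj G e x →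
    ∃ λ γ → γ ≢ 0F × Free (G ∖ X) f e γ
  spare {G} {f} {X} {x} {e} C N x∈ ex with degree {G ∖ X} e
  ... | deg₀ h with avoid₂ (f e) 0F
  ...   | γ , γ≢0 , γ≢e , _ = γ , γ≢0 , γ≢e , λ a → ⊥-elim (h a)
  spare {f = f} {e = e} C N x∈ ex | deg₁ {a} (n₁ _ cov) with avoid₂ (f e) (f a)
  ...   | γ , γ≢0 , γ≢e , γ≢a = γ , γ≢0 , γ≢e , λ {w} w∈ → ≢⇒Compatible λ q → γ≢a (trans q (cong f (cov w∈)))
  spare {f = f} {e = e} C N x∈ ex | deg₂ {a} {b} (n₂ ea eb a≢b cov) with f e ≟ 0F
  ...   | yes e≡0 with avoid₂ (f a) (f b)
  ...     | γ , γ≢0 , γ≢a , γ≢b = γ , γ≢0 , (λ q → γ≢0 (trans q e≡0)) , λ w∈ → ≢⇒Compatible λ q →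
              [ (λ w≡ → γ≢a (trans q (cong f w≡))) , (λ w≡ → γ≢b (trans q (cong f w≡))) ]′ (cov w∈)
  -- Here `e`, `a` and `b` might carry all three nonzero colours; maximality makes `a` or `b` zero,
  -- which forbids no nonzero colour.
  spare {f = f} {e = e} C N x∈ ex | deg₂ {a} {b} (n₂ ea eb a≢b cov) | no e≢0 with Nice.maximal N e≢0
  ...     | w , ew , w≡0 with cov ew
  ...       | inj₁ refl with avoid₂ (f e) (f b)
  ...         | γ , γ≢0 , γ≢e , γ≢b = γ , γ≢0 , γ≢e , λ z∈ → ≢⇒Compatible λ q →
                [ (λ z≡ → γ≢0 (trans q (trans (cong f z≡) w≡0))) , (λ z≡ → γ≢b (trans q (cong f z≡))) ]′ (cov z∈)
  spare {f = f} {e = e} C N x∈ ex | deg₂ {a} {b} (n₂ ea eb a≢b cov) | no e≢0 | w , ew , w≡0 | inj₂ refl with avoid₂ (f e) (f a)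
  ...         | γ , γ≢0 , γ≢e , γ≢a = γ , γ≢0 , γ≢e , λ z∈ → ≢⇒Compatible λ q →
                [ (λ z≡ → γ≢a (trans q (cong f z≡))) , (λ z≡ → γ≢0 (trans q (trans (cong f z≡) w≡0))) ]′ (cov z∈)
  -- The deleted `x` would be a fourth neighbour of `e`.
  spare C N x∈ ex | deg₃ (n₃ (p , _ , p∉) (q , _ , q∉) (r , _ , r∉) s t u) with Class.subcubic C (n₃ p q r s t u) ex
  ... | inj₁ refl = clash x∈ p∉
  ... | inj₂ (inj₁ refl) = clash x∈ q∉
  ... | inj₂ (inj₂ refl) = clash x∈ r∉

  -- Recolouring a vertex without a 0-neighbour to 0 is always possible.
  maximise : ∀ {G} → Good G → ∃ (Nice G)
  maximise {G} (f , V , L) with sweep (allFin n)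
    where
    open Graph G renaming (sym to symm)
    -- Zeros are only added: vertices already treated keep their 0-neighbour, and leaves of colour 0
    -- keep their colour.
    sweep : ∀ xs → ∃ λ g → Valid G g × (∀ {x} → f x ≡ 0F → g x ≡ 0F) ×
      (∀ {x} → x ∈ xs → g x ≢ 0F → ∃ λ w → Adj x w × g w ≡ 0F)
    sweep [] = f , V , id , λ ()
    sweep (v ∷ xs) with sweep xs
    ... | g , W , z , m with any? (λ w → adj? v w ×-dec (g w ≟ 0F))
    ...   | yes w = g , W , z , λ { (here refl) _ → w ; (there x∈) ne → m x∈ ne }
    ...   | no none = h , record { proper = proper ; apart = apart } , (λ e → still (z e)) , max
      where
      module W = Valid W
      h : Fin n → Colour
      h x with x ≟ v
      ... | yes _ = 0F
      ... | no _  = g x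
      h-cases : ∀ x → (x ≡ v × h x ≡ 0F) ⊎ h x ≡ g x
      h-cases x with x ≟ v
      ... | yes e = inj₁ (e , refl)
      ... | no _  = inj₂ refl
      still : ∀ {x} → g x ≡ 0F → h x ≡ 0F
      still {x} e with h-cases x
      ... | inj₁ (_ , q) = q
      ... | inj₂ q = trans q e
      proper : ∀ {x y} → Adj x y → h x ≢ h y
      proper {x} {y} a e with h-cases x | h-cases y
      ... | inj₁ (refl , _) | inj₁ (refl , _) = irrefl a
      ... | inj₁ (refl , p) | inj₂ q = none (y , a , trans (sym q) (trans (sym e) p))
      ... | inj₂ p | inj₁ (refl , q) = none (x , symm a , trans (sym p) (trans e q))
      ... | inj₂ p | inj₂ q = W.proper a (trans (sym p) (trans e q))
      apart : ∀ {x y y′} → Adj x y → Adj x y′ → y ≢ y′ → Compatible (h y) (h y′)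
      apart {x} {y} {y′} a b ne with h-cases y | h-cases y′
      ... | inj₁ (_ , p) | _ = 0-compatible p
      ... | _ | inj₁ (_ , q) = compatible-0 q
      ... | inj₂ p | inj₂ q rewrite p | q = W.apart a b ne
      max : ∀ {x} → x ∈ v ∷ xs → h x ≢ 0F → ∃ λ w → Adj x w × h w ≡ 0F
      max {x} x∈ ne with h-cases x | x∈
      ... | inj₁ (_ , p) | _ = ⊥-elim (ne p)
      ... | inj₂ p | here refl = ⊥-elim (ne h-v)
        where
        h-v : h x ≡ 0F
        h-v with x ≟ x
        ... | yes _ = refl
        ... | no ¬e = ⊥-elim (¬e refl)
      ... | inj₂ p | there x∈′ with m x∈′ (λ e → ne (trans p e))
      ...   | w , a , e = w , a , still e
  ... | g , W , z , m = g , record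
    { valid = W
    ; leafy = λ l → [ (λ e → inj₁ (z e)) , inj₂ ]′ (L l)
    ; maximal = m (∈-allFin _) }

-- Minimal counterexamples: pendant paths, twins, diamonds

module _ {n : ℕ} where

  pattern 1st e = here e
  pattern 2nd e = there (here e)
  pattern 3rd e = there (there (here e))
  pattern 4th e = there (there (there (here e)))

  Free-⊑ : ∀ {G H : Graph n} {f v k} → H ⊑ G → Free G f v k → Free H f v k
  Free-⊑ s (p , q) = p , λ a → q (s a)

  Free-isolated : ∀ {G : Graph n} {f v k} → (∀ {w} → ¬ Graph.Adj G v w) → f v ≡ 0F → k ≢ 0F → Free G f v k
  Free-isolated h v≡0 k≢0 = (λ e → k≢0 (trans e v≡0)) , λ a → ⊥-elim (h a)

  module _ (H : Graph n) {f : Fin n → Colour} where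
    open Graph H using (Adj)

    -- The conditions at a deleted vertex u of colour k whose two deleted neighbours get colours l and m.
    Fitting : List (Fin n) → Fin n → Fin n → (k l m : Colour) → Set
    Fitting X u o k l m = Adj u o → Free (H ∖ X) f o k × Compatible (f o) l × Compatible (f o) m

    triangle-paint : ∀ {u v w} {u′ v′ w′ : Fin n} {k l m} → let X = u ∷ v ∷ w ∷ [] in
      Valid (H ∖ X) f → u ≢ v → u ≢ w → v ≢ w → k ≢ l → k ≢ m → l ≢ m →
      (∀ {z} → Adj u z → z ≡ v ⊎ z ≡ w ⊎ z ≡ u′) →
      (∀ {z} → Adj v z → z ≡ u ⊎ z ≡ w ⊎ z ≡ v′) →
      (∀ {z} → Adj w z → z ≡ u ⊎ z ≡ v ⊎ z ≡ w′) →
      Fitting X u u′ k l m → Fitting X v v′ l k m → Fitting X w w′ m k l →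
      Painting H (⟨ u , k , u′ ⟩ ∷ ⟨ v , l , v′ ⟩ ∷ ⟨ w , m , w′ ⟩ ∷ []) f
    triangle-paint V u≢v u≢w v≢w k≢l k≢m l≢m cu cv cw fu fv fw = extend-paint _ V
      (((u≢v , k≢l , (λ a → proj₁ (proj₂ (fu a))) , (λ a → proj₁ (proj₂ (fv a)))) ∷
        (u≢w , k≢m , (λ a → proj₂ (proj₂ (fu a))) , (λ a → proj₁ (proj₂ (fw a)))) ∷ []) ∷
       ((v≢w , l≢m , (λ a → proj₂ (proj₂ (fv a))) , (λ a → proj₂ (proj₂ (fw a)))) ∷ []) ∷ [] ∷ [])
      ((λ a → [ (λ { refl → inj₁ (2nd refl) }) , [ (λ { refl → inj₁ (3rd refl) }) , inj₂ ]′ ]′ (cu a)) ∷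
       (λ a → [ (λ { refl → inj₁ (1st refl) }) , [ (λ { refl → inj₁ (3rd refl) }) , inj₂ ]′ ]′ (cv a)) ∷
       (λ a → [ (λ { refl → inj₁ (1st refl) }) , [ (λ { refl → inj₁ (2nd refl) }) , inj₂ ]′ ]′ (cw a)) ∷ [])
      ((λ a → proj₁ (fu a)) ∷ (λ a → proj₁ (fv a)) ∷ (λ a → proj₁ (fw a)) ∷ [])

  -- `ih` provides `Nice` colourings while `bad` only refuses `Good` ones, so maximality can be used
  -- but never has to be restored. Doubly negated existence suffices, as every use aims at `⊥`.
  record Minimal (G : Graph n) : Set where
    field
      class : Class G
      ih    : ∀ X {x y} → x ∈ X → Graph.Adj G x y → ¬ ¬ ∃ (Nice (G ∖ X))
      bad   : ¬ Good G

  module Sparse {G : Graph n} (M : Minimal G) where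
    open Graph G renaming (sym to symm)
    open Minimal M
    open Class class

    absurd : ∀ {v} {A : Set} → Adj v v → A
    absurd a = ⊥-elim (irrefl a)

    -- Such a `y` loses no neighbour. This carries the exception in the leaf condition, a leaf next
    -- to a leaf, back from the smaller graph.
    shield : ∀ {X y} → Fresh y X → (∀ {v} → Adj y v → ¬ v ∈ X) → Leaf (G ∖ X) y → Leaf G y
    shield {X} {y} y∉ h l p q = l (up p) (up q)
      where
      up : ∀ {v} → Adj y v → Graph.Adj (G ∖ X) y v
      up {v} p with fresh? v X
      ... | inj₁ v∈ = ⊥-elim (h p v∈)
      ... | inj₂ v∉ = p , y∉ , v∉

    -- A leaf outside `X` is still a leaf after the deletion. It either has colour 0 already or is
    -- excused by a neighbouring leaf, and the last hypothesis says that the excuse is still good in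
    -- `G`.
    finish : ∀ X {f f′} → Nice (G ∖ X) f′ → Valid G f → (∀ {z} → Fresh z X → f z ≡ f′ z) →
      (∀ {x} → x ∈ X → LeafyAt G f x) →
      (∀ {z y} → Leaf G z → Adj z y → Fresh z X → Fresh y X → Leaf (G ∖ X) y → Leaf G y) → ⊥
    finish X {f} {f′} N V agree inside outside = bad (f , V , leafy)
      where
      leafy : Leafy G f
      leafy {x} l with fresh? x X
      ... | inj₁ x∈ = inside x∈ l
      ... | inj₂ x∉ with Nice.leafy N (λ p q → l (proj₁ p) (proj₁ q))
      ...   | inj₁ e = inj₁ (trans (agree x∉) e)
      ...   | inj₂ (y , (a , _ , y∉) , l′) = inj₂ (y , a , outside l a x∉ y∉ l′)

    -- The exception in the leaf condition is made for this component: `y` gets 1, excused by the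
    -- leaf `x`.
    noK₂ : ∀ {x y} → N₁ G x y → N₁ G y x → ⊥
    noK₂ {x} {y} Nx Ny = ih X (1st refl) xy λ (f , N) → go f N
      where
      xy = N₁.va Nx
      X = x ∷ y ∷ []
      go : ∀ f → Nice (G ∖ X) f → ⊥
      go f N with extend-paint {G = G} (⟨ x , 0F , x ⟩ ∷ ⟨ y , 1F , y ⟩ ∷ []) (Nice.valid N)
        (((≢-adj {G = G} xy , (λ ()) , absurd , absurd) ∷ []) ∷ [] ∷ [])
        ((λ a → inj₁ (2nd (N₁.cover Nx a))) ∷ (λ a → inj₁ (1st (N₁.cover Ny a))) ∷ [])
        (absurd ∷ absurd ∷ [])
      ... | g , V , (gx ∷ _ ∷ []) , agree = finish X N V agree
        (λ { (1st refl) _ → inj₁ gx ; (2nd refl) _ → inj₂ (x , symm xy , leaf₁ Nx) })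
        λ { _ _ _ y∉ → shield y∉ λ
          { a (1st refl) → All.head (All.tail y∉) (N₁.cover Nx (symm a))
          ; a (2nd refl) → All.head y∉ (N₁.cover Ny (symm a)) } }

    -- The argument of `noPendantPath` would leave the isolated edge `y′ x′`, where the leaf `x′`
    -- may be nonzero with an excuse that fails in `G`. Deleting the two inner vertices instead
    -- isolates both ends, which therefore have colour 0.
    noP₄ : ∀ {x y y′ x′} → N₁ G x y → N₂ G y x y′ → N₂ G y′ y x′ → N₁ G x′ y′ → ⊥
    noP₄ {x} {y} {y′} {x′} Nx Ny Ny′ Nx′ = ih X (1st refl) (N₂.va Ny) λ (f , N) → go f N
      where
      X = y ∷ y′ ∷ []
      isoˣ : ∀ {w} → ¬ Graph.Adj (G ∖ X) x w
      isoˣ (a , _ , w∉) = All.head w∉ (N₁.cover Nx a)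
      isoˣ′ : ∀ {w} → ¬ Graph.Adj (G ∖ X) x′ w
      isoˣ′ (a , _ , w∉) = All.head (All.tail w∉) (N₁.cover Nx′ a)
      go : ∀ f → Nice (G ∖ X) f → ⊥
      go f N with quiet N isoˣ | quiet N isoˣ′
      ... | fx | fx′ with extend-paint {G = G} (⟨ y , 1F , x ⟩ ∷ ⟨ y′ , 2F , x′ ⟩ ∷ []) (Nice.valid N)
        (((≢-adj {G = G} (N₂.vb Ny) , (λ ()) , (λ _ → 0-compatible fx) , (λ _ → 0-compatible fx′)) ∷ []) ∷ [] ∷ [])
        ((λ a → [ inj₂ , (λ e → inj₁ (2nd e)) ]′ (N₂.cover Ny a)) ∷
         (λ a → [ (λ e → inj₁ (1st e)) , inj₂ ]′ (N₂.cover Ny′ a)) ∷ [])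
        ((λ _ → Free-isolated {G = G ∖ X} isoˣ fx (λ ())) ∷
         (λ _ → Free-isolated {G = G ∖ X} isoˣ′ fx′ (λ ())) ∷ [])
      ... | g , V , _ , agree = finish X N V agree
        (λ { (1st refl) → ¬leaf {G = G} (N₂.va Ny) (N₂.vb Ny) (N₂.a≢b Ny)
           ; (2nd refl) → ¬leaf {G = G} (N₂.va Ny′) (N₂.vb Ny′) (N₂.a≢b Ny′) })
        outside
        where
        outside : ∀ {z t} → Leaf G z → Adj z t → Fresh z X → Fresh t X → Leaf (G ∖ X) t → Leaf G t
        outside {t = t} _ _ _ (t≢y ∷ t≢y′ ∷ []) l with t ≟ x | t ≟ x′
        ... | yes refl | _ = leaf₁ Nx
        ... | _ | yes refl = leaf₁ Nx′
        ... | no t≢x | no t≢x′ = shield (t≢y ∷ t≢y′ ∷ []) (λ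
          { a (1st refl) → [ t≢x , t≢y′ ]′ (N₂.cover Ny (symm a))
          ; a (2nd refl) → [ t≢y , t≢x′ ]′ (N₂.cover Ny′ (symm a)) }) l

    noPendantPath : ∀ {x y y′} → N₁ G x y → N₂ G y x y′ → ⊥
    noPendantPath {x} {y} {y′} Nx Ny = ih X (1st refl) (N₁.va Nx) λ (f , N) → go f N
      where
      X = x ∷ y ∷ []
      go : ∀ f → Nice (G ∖ X) f → ⊥
      go f N with spare class N (2nd refl) (symm (N₂.vb Ny))
      ... | γ , γ≢0 , free with extend-paint {G = G} (⟨ x , 0F , x ⟩ ∷ ⟨ y , γ , y′ ⟩ ∷ []) (Nice.valid N)
        (((≢-adj {G = G} (N₁.va Nx) , ≢-sym γ≢0 , absurd , λ _ → compatible-0 refl) ∷ []) ∷ [] ∷ [])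
        ((λ a → inj₁ (2nd (N₁.cover Nx a))) ∷
         (λ a → [ (λ e → inj₁ (1st e)) , inj₂ ]′ (N₂.cover Ny a)) ∷ [])
        (absurd ∷ (λ _ → free) ∷ [])
      ... | g , V , (gx ∷ _ ∷ []) , agree = finish X N V agree
        (λ { (1st refl) _ → inj₁ gx
           ; (2nd refl) → ¬leaf {G = G} (N₂.va Ny) (N₂.vb Ny) (N₂.a≢b Ny) })
        outside
        where
        outside : ∀ {z t} → Leaf G z → Adj z t → Fresh z X → Fresh t X → Leaf (G ∖ X) t → Leaf G t
        outside {z} {t} lz zt z∉ t∉@(t≢x ∷ t≢y ∷ []) l with t ≟ y′
        ... | no t≢y′ = shield t∉ (λ
          { a (1st refl) → t≢y (N₁.cover Nx (symm a))
          ; a (2nd refl) → [ t≢x , t≢y′ ]′ (N₂.cover Ny (symm a)) }) l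
        -- The leaf `z` claims to be excused by `y′`. Either `y′` has no further neighbour, and the
        -- component is a path on four vertices, or a third neighbour survives and `y′` is no leaf.
        ... | yes refl with from₂ {G = G} (symm (N₂.vb Ny)) (symm zt) (≢-sym (All.head (All.tail z∉)))
        ...   | inj₁ Nt = ⊥-elim (noP₄ Nx Ny Nt (from-leaf {G = G} zt lz))
        ...   | inj₂ (s , n₃ ty tz ts y≢z y≢s z≢s) =
          ⊥-elim (z≢s (l (symm zt , t∉ , z∉) (ts , t∉ , s≢x ∷ ≢-sym y≢s ∷ [])))
          where
          s≢x : s ≢ x
          s≢x refl = t≢y (N₁.cover Nx (symm ts))

    leaf-support : ∀ {x y} → N₁ G x y → Three G y
    leaf-support {x} {y} Nx with degree {G = G} y
    ... | deg₀ h = ⊥-elim (h (symm (N₁.va Nx)))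
    ... | deg₁ Ny@(n₁ _ cov) with cov (symm (N₁.va Nx))
    ...   | refl = ⊥-elim (noK₂ Nx Ny)
    leaf-support Nx | deg₂ Ny with N₂.cover Ny (symm (N₁.va Nx))
    ...   | inj₁ refl = ⊥-elim (noPendantPath Nx Ny)
    ...   | inj₂ refl = ⊥-elim (noPendantPath Nx (swap₂ Ny))
    leaf-support Nx | deg₃ Ny = _ , _ , _ , Ny

    -- The neighbour of a leaf has degree 3. If it loses at most one neighbour it does not become a
    -- leaf, so no leaf outside `X` is excused; and `X` itself contains no leaf.
    finish₂ : ∀ X {f f′} → Nice (G ∖ X) f′ → Valid G f → (∀ {z} → Fresh z X → f z ≡ f′ z) →
      All (λ x → ∃ λ a → ∃ λ b → Adj x a × Adj x b × a ≢ b) X →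
      (∀ {y a b} → Fresh y X → a ∈ X → b ∈ X → Adj y a → Adj y b → a ≡ b) → ⊥
    finish₂ X N V agree branching single = finish X N V agree
      (λ x∈ → let _ , _ , p , q , d = All.lookup branching x∈ in ¬leaf {G = G} p q d) outside
      where
      outside : ∀ {z y} → Leaf G z → Adj z y → Fresh z X → Fresh y X → Leaf (G ∖ X) y → Leaf G y
      outside {z} {y} lz zy z∉ y∉ l with last₃ {G = G} class (leaf-support (from-leaf {G = G} zy lz)) (symm zy)
      ... | a , b , n₃ ya yb yz a≢b a≢z b≢z with fresh? a X | fresh? b X
      ...   | inj₂ a∉ | _ = ⊥-elim (a≢z (l (ya , y∉ , a∉) (yz , y∉ , z∉)))
      ...   | _ | inj₂ b∉ = ⊥-elim (b≢z (l (yb , y∉ , b∉) (yz , y∉ , z∉)))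
      ...   | inj₁ a∈ | inj₁ b∈ = ⊥-elim (a≢b (single y∉ a∈ b∈ ya yb))

    spare? : ∀ {f X x} e → Nice (G ∖ X) f → x ∈ X → ∃ λ γ → γ ≢ 0F × (Adj x e → Free (G ∖ X) f e γ)
    spare? {x = x} e N x∈ with adj? x e
    -- An arbitrary nonzero colour, since there is nothing to be compatible with.
    ... | no ¬a = 1F , (λ ()) , λ a → ⊥-elim (¬a a)
    ... | yes a with spare class N x∈ (symm a)
    ...   | γ , γ≢0 , free = γ , γ≢0 , λ _ → free

    -- `v` takes a colour spare at `c`, `a` takes 0, and `b` avoids `c` at distance two. If `v` has
    -- no third neighbour, `c` is a dummy.
    noTwins : ∀ {v a b c} → Adj v a → Adj v b → N₂ G a v b → N₂ G b v a →
      (∀ {z} → Adj v z → z ≡ a ⊎ z ≡ b ⊎ z ≡ c) → ⊥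
    noTwins {v} {a} {b} {c} va vb Na Nb cov = ih X (1st refl) va λ (f , N) → go f N
      where
      X = v ∷ a ∷ b ∷ []
      v≢a = ≢-adj {G = G} va
      v≢b = ≢-adj {G = G} vb
      a≢b = ≢-adj {G = G} (N₂.vb Na)
      from-v : ∀ {y s} → Fresh y X → s ∈ X → Adj y s → s ≡ v
      from-v _ (1st e) _ = e
      from-v (y≢v ∷ _ ∷ y≢b ∷ []) (2nd refl) e = ⊥-elim ([ y≢v , y≢b ]′ (N₂.cover Na (symm e)))
      from-v (y≢v ∷ y≢a ∷ _) (3rd refl) e = ⊥-elim ([ y≢v , y≢a ]′ (N₂.cover Nb (symm e)))
      go : ∀ f → Nice (G ∖ X) f → ⊥
      go f N with spare? c N (1st refl)
      ... | γ , γ≢0 , free with avoid₂ γ (f c)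
      ...   | κ , κ≢0 , κ≢γ , κ≢c with triangle-paint G (Nice.valid N) v≢a v≢b a≢b γ≢0 (≢-sym κ≢γ) (≢-sym κ≢0)
              cov
              (λ e → [ inj₁ , (λ p → inj₂ (inj₁ p)) ]′ (N₂.cover Na e))
              (λ e → [ inj₁ , (λ p → inj₂ (inj₁ p)) ]′ (N₂.cover Nb e))
              (λ e → free e , compatible-0 refl , ≢⇒Compatible (≢-sym κ≢c))
              (absurd {v = a}) (absurd {v = b})
      ...     | g , V , _ , agree = finish₂ X N V agree
        ((_ , _ , va , vb , a≢b) ∷ (_ , _ , N₂.va Na , N₂.vb Na , N₂.a≢b Na) ∷
         (_ , _ , N₂.va Nb , N₂.vb Nb , N₂.a≢b Nb) ∷ [])
        λ y∉ p q r s → trans (from-v y∉ p r) (sym (from-v y∉ q s))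

    -- The leaf `x` is kept: it becomes isolated, so it has colour 0 and forbids nothing nonzero at
    -- `y`. Only `z′` then matters.
    noHatLeaf : ∀ {x y z w z′} → N₁ G x y → N₃ G y z w x → N₃ G z y w z′ → N₂ G w y z → ⊥
    noHatLeaf {x} {y} {z} {w} {z′} Nx Ny Nz Nw = ih X (1st refl) (N₃.va Ny) λ (f , N) → go f N
      where
      X = y ∷ z ∷ w ∷ []
      iso : ∀ {t} → ¬ Graph.Adj (G ∖ X) x t
      iso (a , _ , t∉) = All.head t∉ (N₁.cover Nx a)
      out : Fin n → Fin n → Set
      out s t = (s ≡ y × t ≡ x) ⊎ (s ≡ z × t ≡ z′)
      outs : ∀ {t s} → Fresh t X → s ∈ X → Adj t s → out s t
      outs (_ ∷ t≢z ∷ t≢w ∷ []) (1st refl) e = inj₁ (refl , same₃ {G = G} class Ny (symm e) t≢z t≢w)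
      outs (t≢y ∷ _ ∷ t≢w ∷ []) (2nd refl) e = inj₂ (refl , same₃ {G = G} class Nz (symm e) t≢y t≢w)
      outs (t≢y ∷ t≢z ∷ _) (3rd refl) e = ⊥-elim ([ t≢y , t≢z ]′ (N₂.cover Nw (symm e)))
      x≢z′ : x ≢ z′
      x≢z′ refl = ≢-adj {G = G} (N₃.va Ny) (sym (N₁.cover Nx (symm (N₃.vc Nz))))
      single : ∀ {t a b} → Fresh t X → a ∈ X → b ∈ X → Adj t a → Adj t b → a ≡ b
      single t∉ p q r s with outs t∉ p r | outs t∉ q s
      ... | inj₁ (refl , _) | inj₁ (refl , _) = refl
      ... | inj₂ (refl , _) | inj₂ (refl , _) = refl
      ... | inj₁ (_ , refl) | inj₂ (_ , e) = ⊥-elim (x≢z′ e)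
      ... | inj₂ (_ , e) | inj₁ (_ , refl) = ⊥-elim (x≢z′ e)
      go : ∀ f → Nice (G ∖ X) f → ⊥
      go f N with spare class N (2nd refl) (symm (N₃.vc Nz))
      ... | γ , γ≢0 , free with avoid₂ γ (f z′)
      ...   | κ , κ≢0 , κ≢γ , κ≢z′ with triangle-paint G (Nice.valid N)
              (≢-adj {G = G} (N₃.va Ny)) (≢-adj {G = G} (N₃.vb Ny)) (≢-adj {G = G} (N₃.vb Nz)) κ≢γ κ≢0 γ≢0
              (subcubic Ny) (subcubic Nz) (λ e → [ inj₁ , (λ p → inj₂ (inj₁ p)) ]′ (N₂.cover Nw e))
              (λ _ → Free-isolated {G = G ∖ X} iso (quiet N iso) κ≢0 , 0-compatible (quiet N iso) , 0-compatible (quiet N iso))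
              (λ _ → free , ≢⇒Compatible (≢-sym κ≢z′) , compatible-0 refl)
              (absurd {v = w})
      ...     | g , V , _ , agree = finish₂ X N V agree
        ((_ , _ , N₃.va Ny , N₃.vb Ny , N₃.a≢b Ny) ∷ (_ , _ , N₃.va Nz , N₃.vb Nz , N₃.a≢b Nz) ∷
         (_ , _ , N₂.va Nw , N₂.vb Nw , N₂.a≢b Nw) ∷ [])
        single

    -- `w`, `a` and `c` use up the nonzero colours, so they cannot all differ from a nonzero `f e`.
    -- They need not: `a` is not within distance two of `e` through `c`. Painting `c` on its own
    -- before the triangle expresses this, with 0 on `v`.
    noDiamond : ∀ {v w a c e} → N₃ G v w a c → N₃ G w v a c → N₂ G a v w →
      (∀ {z} → Adj c z → z ≡ v ⊎ z ≡ w ⊎ z ≡ e) → ⊥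
    noDiamond {v} {w} {a} {c} {e} Nv Nw Na cov = ih X (1st refl) (N₃.va Nv) λ (f , N) → go f N
      where
      T = v ∷ w ∷ a ∷ []
      X = T ++ c ∷ []
      H = G ∖ T
      cv = symm (N₃.vc Nv)
      cw = symm (N₃.vc Nw)
      from-c : ∀ {t s} → Fresh t X → s ∈ X → Adj t s → s ≡ c
      from-c (_ ∷ t≢w ∷ t≢a ∷ t≢c ∷ []) (1st refl) r = ⊥-elim ([ t≢w , [ t≢a , t≢c ]′ ]′ (subcubic Nv (symm r)))
      from-c (t≢v ∷ _ ∷ t≢a ∷ t≢c ∷ []) (2nd refl) r = ⊥-elim ([ t≢v , [ t≢a , t≢c ]′ ]′ (subcubic Nw (symm r)))
      from-c (t≢v ∷ t≢w ∷ _) (3rd refl) r = ⊥-elim ([ t≢v , t≢w ]′ (N₂.cover Na (symm r)))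
      from-c _ (4th r) _ = r
      go : ∀ f → Nice (G ∖ X) f → ⊥
      go f N with spare? e N (4th refl)
      ... | γ , γ≢0 , free with extend-paint {G = H} (⟨ c , γ , e ⟩ ∷ []) (Valid-⊑ (∖∖⊑ {G = G} {X = T}) (Nice.valid N))
        ([] ∷ [])
        ((λ { (p , _ , z≢v ∷ z≢w ∷ _) → [ (λ q → ⊥-elim (z≢v q)) , [ (λ q → ⊥-elim (z≢w q)) , inj₂ ]′ ]′ (cov p) }) ∷ [])
        ((λ p → Free-⊑ {G = G ∖ X} {H = H ∖ (c ∷ [])} {f = f} {v = e} (∖∖⊑ {G = G} {X = T}) (free (proj₁ p))) ∷ [])
      ... | f₁ , V₁ , (c≡γ ∷ []) , agree₁ with avoid₂ γ (f e)
      ...   | κ , κ≢0 , κ≢γ , κ≢e with avoid₂ γ κ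
      ...     | μ , μ≢0 , μ≢γ , μ≢κ with triangle-paint G V₁
        (≢-adj {G = G} (N₃.va Nv)) (≢-adj {G = G} (N₃.vb Nv)) (≢-adj {G = G} (N₃.vb Nw)) (≢-sym κ≢0) (≢-sym μ≢0) (≢-sym μ≢κ)
        (λ p → [ inj₁ , [ (λ q → inj₂ (inj₁ q)) , (λ q → inj₂ (inj₂ q)) ]′ ]′ (subcubic Nv p))
        (subcubic Nw) (λ r → [ inj₁ , (λ p → inj₂ (inj₁ p)) ]′ (N₂.cover Na r))
        (λ _ → Free-0 {G = G ∖ T} refl (λ q → γ≢0 (trans (sym c≡γ) q)) ,
          ≢⇒Compatible (λ q → κ≢γ (trans (sym q) c≡γ)) , ≢⇒Compatible (λ q → μ≢γ (trans (sym q) c≡γ)))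
        (λ _ → ((λ q → κ≢γ (trans q c≡γ)) , at-e) , compatible-0 refl , ≢⇒Compatible (λ q → μ≢γ (trans (sym q) c≡γ)))
        (absurd {v = a})
        where
        at-e : ∀ {z} → Graph.Adj (G ∖ T) c z → Compatible κ (f₁ z)
        at-e (p , _ , z≢v ∷ z≢w ∷ _) with cov p
        ... | inj₁ q = ⊥-elim (z≢v q)
        ... | inj₂ (inj₁ q) = ⊥-elim (z≢w q)
        ... | inj₂ (inj₂ refl) = ≢⇒Compatible λ q → κ≢e (trans q (agree₁ (≢-sym (≢-adj {G = G} p) ∷ [])))
      ...       | g , V , _ , agree = finish₂ X N V
        (λ z∉ → trans (agree (++⁻ˡ T z∉)) (agree₁ (++⁻ʳ T z∉)))
        ((_ , _ , N₃.va Nv , N₃.vb Nv , N₃.a≢b Nv) ∷ (_ , _ , N₃.va Nw , N₃.vb Nw , N₃.a≢b Nw) ∷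
         (_ , _ , N₂.va Na , N₂.vb Na , N₂.a≢b Na) ∷ (_ , _ , cv , cw , ≢-adj {G = G} (N₃.va Nv)) ∷ [])
        λ y∉ p q r s → trans (from-c y∉ p r) (sym (from-c y∉ q s))

-- Triangles, their outer neighbours, and the absence of leaves

module _ {n : ℕ} where

  -- The apex `x` has degree 2, and `y′ ≢ z′` excludes the diamond.
  record Hat (G : Graph n) (y z x y′ z′ : Fin n) : Set where
    constructor hat
    field
      ny    : N₃ G y z x y′
      nz    : N₃ G z y x z′
      nx    : N₂ G x y z
      y′≢z′ : y′ ≢ z′

  record Tri (G : Graph n) (u v w u′ v′ w′ : Fin n) : Set where
    constructor tri
    field
      nu    : N₃ G u v w u′
      nv    : N₃ G v w u v′
      nw    : N₃ G w u v w′
      u′≢v′ : u′ ≢ v′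
      v′≢w′ : v′ ≢ w′
      w′≢u′ : w′ ≢ u′

  -- `c` is the neighbour of `v` off the triangle.
  data Shape (G : Graph n) (v c : Fin n) : Set where
    is-hat : ∀ {z x z′} → Hat G v z x c z′ → Shape G v c
    is-tri : ∀ {a b a′ b′} → Tri G v a b c a′ b′ → Shape G v c

  module _ {G : Graph n} where
    swap-last : ∀ {v a b c} → N₃ G v a b c → N₃ G v a c b
    swap-last N = rotate₃ (swap₃ N)

    flip-hat : ∀ {y z x y′ z′} → Hat G y z x y′ z′ → Hat G z y x z′ y′
    flip-hat (hat a b c d) = hat b a (swap₂ c) (≢-sym d)

    cycle : ∀ {u v w u′ v′ w′} → Tri G u v w u′ v′ w′ → Tri G v w u v′ w′ u′
    cycle (tri a b c d e f) = tri b c a e f d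

    mirror : ∀ {u v w u′ v′ w′} → Tri G u v w u′ v′ w′ → Tri G u w v u′ w′ v′
    mirror (tri a b c d e f) = tri (swap₃ a) (swap₃ c) (swap₃ b) (≢-sym f) (≢-sym e) (≢-sym d)

  module Twins (H : Graph n) {f : Fin n → Colour} {e h m : Fin n} where
    open Graph H using (Adj; irrefl) renaming (sym to symm)

    Swapped : Set
    Swapped = ∃ λ g → Valid H g × g e ≡ f h × g h ≡ f e ×
      (∀ {z} → Fresh z (e ∷ h ∷ []) → g z ≡ f z)

    -- Apart from each other, `e` and `h` have the same neighbour `m`, so the exchange amounts to an
    -- automorphism.
    swap-twins : Valid H f → Adj e h → Adj e m → Adj h m →
      (∀ {z} → Adj e z → z ≡ h ⊎ z ≡ m) → (∀ {z} → Adj h z → z ≡ e ⊎ z ≡ m) → Swapped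
    swap-twins V eh em hm ce ch with extend-paint {G = H} (⟨ e , f h , m ⟩ ∷ ⟨ h , f e , m ⟩ ∷ [])
        (Valid-⊑ {G = H} proj₁ V)
        (((≢-adj {G = H} eh , (λ q → proper eh (sym q)) ,
          (λ _ → ≢⇒Compatible (proper (symm em))) , (λ _ → ≢⇒Compatible (proper (symm hm)))) ∷ []) ∷ [] ∷ [])
        ((λ a → [ (λ { refl → inj₁ (2nd refl) }) , inj₂ ]′ (ce a)) ∷
         (λ a → [ (λ { refl → inj₁ (1st refl) }) , inj₂ ]′ (ch a)) ∷ [])
        ((λ _ → proper hm , λ { (a , _ , _ ∷ w≢h ∷ []) → apart (symm hm) a (≢-sym w≢h) }) ∷
         (λ _ → proper em , λ { (a , _ , w≢e ∷ _) → apart (symm em) a (≢-sym w≢e) }) ∷ [])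
      where open Valid V
    ... | g , W , (ge ∷ gh ∷ []) , agree = g , W , ge , gh , agree

  module Triangles {G : Graph n} (M : Minimal G) where
    open Graph G renaming (sym to symm)
    open Minimal M
    open Class class
    open Sparse M

    cover₂ : ∀ {c v w} → Adj c v → Adj c w → v ≢ w → ∃ λ e → ∀ {z} → Adj c z → z ≡ v ⊎ z ≡ w ⊎ z ≡ e
    cover₂ {v = v} p q d with from₂ {G = G} p q d
    ... | inj₁ N = v , λ a → [ inj₁ , (λ r → inj₂ (inj₁ r)) ]′ (N₂.cover N a)
    ... | inj₂ (e , N) = e , subcubic N

    low : ∀ {c v w} → Adj c v → Adj c w → v ≢ w → ¬ Three G c → N₂ G c v w
    low p q d ¬3 with from₂ {G = G} p q d
    ... | inj₁ N = N
    ... | inj₂ (_ , N) = ⊥-elim (¬3 (_ , _ , _ , N))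

    shape : ∀ {v a b c} → N₃ G v a b c → Adj a b → Shape G v c
    shape {v} {a} {b} {c} N@(n₃ va vb vc a≢b a≢c b≢c) ab
      with from₂ {G = G} (symm va) ab (≢-adj {G = G} vb) | from₂ {G = G} (symm vb) (symm ab) (≢-adj {G = G} va)
    ... | inj₁ Na | inj₁ Nb = ⊥-elim (noTwins va vb Na Nb (subcubic N))
    ... | inj₁ Na | inj₂ (b′ , Nb) with c ≟ b′
    ...   | no c≢b′ = is-hat (hat (swap₃ N) Nb Na c≢b′)
    ...   | yes refl = ⊥-elim (noDiamond (swap₃ N) Nb Na
              (proj₂ (cover₂ (symm vc) (symm (N₃.vc Nb)) (≢-adj {G = G} vb))))
    shape {v} {a} {b} {c} N@(n₃ va vb vc a≢b a≢c b≢c) ab | inj₂ (a′ , Na) | inj₁ Nb with c ≟ a′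
    ...   | no c≢a′ = is-hat (hat N Na Nb c≢a′)
    ...   | yes refl = ⊥-elim (noDiamond N Na Nb
              (proj₂ (cover₂ (symm vc) (symm (N₃.vc Na)) (≢-adj {G = G} va))))
    shape {v} {a} {b} {c} N@(n₃ va vb vc a≢b a≢c b≢c) ab | inj₂ (a′ , Na) | inj₂ (b′ , Nb)
      with c ≟ a′ | c ≟ b′ | a′ ≟ b′
    -- In a diamond with two further vertices of degree 3, saturation pushes the remaining one down
    -- to degree 2; this is the form that `noDiamond` needs.
    ... | yes refl | _ | _ = ⊥-elim (noDiamond (swap-last N) (swap-last Na)
            (low (symm vc) (symm (N₃.vc Na)) (≢-adj {G = G} va) (saturated N (_ , _ , _ , Na) (_ , _ , _ , Nb)))
            (subcubic Nb))
    ... | _ | yes refl | _ = ⊥-elim (noDiamond (rotate₃ N) (swap-last Nb)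
            (low (symm vc) (symm (N₃.vc Nb)) (≢-adj {G = G} vb) (saturated N (_ , _ , _ , Na) (_ , _ , _ , Nb)))
            (subcubic Na))
    ... | _ | _ | yes refl = ⊥-elim (noDiamond (rotate₃ Na) (rotate₃ Nb)
            (low (symm (N₃.vc Na)) (symm (N₃.vc Nb)) a≢b (saturated Na (_ , _ , _ , N) (_ , _ , _ , Nb)))
            (subcubic N))
    ... | no c≢a′ | no c≢b′ | no a′≢b′ = is-tri (tri N (swap₃ Na) Nb c≢a′ a′≢b′ (≢-sym c≢b′))

    -- Having lost `x`, the vertex `c` is isolated or a leaf. If it were excused by a leaf `q`, then
    -- `q`, which loses nothing, would be a leaf of `G`, and `leaf-support` would give `c` degree 3.
    outer₀ : ∀ {X f c x} → Nice (G ∖ X) f → x ∈ X → Adj c x → ¬ Three G c →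
      (∀ {q} → Adj c q → q ≢ x → Fresh q X → ∀ {r} → Adj q r → r ∈ X → ⊥) → f c ≡ 0F
    outer₀ {X} {f} {c} {x} N x∈ cx ¬3 second with degree {G = G} c
    ... | deg₀ h = ⊥-elim (h cx)
    ... | deg₃ N = ⊥-elim (¬3 (_ , _ , _ , N))
    ... | deg₁ Nc = quiet N λ (a , _ , w∉) → clash x∈ (subst (λ t → Fresh t X) (trans (N₁.cover Nc a) (sym (N₁.cover Nc cx))) w∉)
    ... | deg₂ Nc = go (other Nc)
      where
      other : ∀ {a b} → N₂ G c a b → ∃ λ q → N₂ G c x q
      other N with N₂.cover N cx
      ... | inj₁ refl = _ , N
      ... | inj₂ refl = _ , swap₂ N
      go : (∃ λ q → N₂ G c x q) → f c ≡ 0F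
      go (q , Nc) with fresh? q X
      ... | inj₁ q∈ = quiet N λ (a , _ , w∉) →
              [ (λ { refl → clash x∈ w∉ }) , (λ { refl → clash q∈ w∉ }) ]′ (N₂.cover Nc a)
      ... | inj₂ q∉ with Nice.leafy N leaf′
        where
        leaf′ : Leaf (G ∖ X) c
        leaf′ (p , _ , v∉) (p′ , _ , w∉) with N₂.cover Nc p | N₂.cover Nc p′
        ... | inj₁ refl | _ = clash x∈ v∉
        ... | _ | inj₁ refl = clash x∈ w∉
        ... | inj₂ r | inj₂ s = trans r (sym s)
      ...   | inj₁ e = e
      ...   | inj₂ (y , (cy , _ , y∉) , l) with N₂.cover Nc cy
      ...     | inj₁ refl = clash x∈ y∉
      ...     | inj₂ refl = ⊥-elim (¬3 (leaf-support (from-leaf {G = G} (symm cy)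
                  (shield q∉ (second cy (≢-sym (N₂.a≢b Nc)) q∉) l))))

    -- `ξ` is the colour of the one remaining neighbour of `c`, or 0 if there is none.
    free₁ : ∀ {X f c x} → x ∈ X → Adj c x → ¬ Three G c → f c ≡ 0F →
      ∃ λ ξ → ∀ {k} → k ≢ 0F → k ≢ ξ → Free (G ∖ X) f c k
    free₁ {X} {f} {c} {x} x∈ cx ¬3 c≡0 with degree {G = G} c
    ... | deg₀ h = ⊥-elim (h cx)
    ... | deg₃ N = ⊥-elim (¬3 (_ , _ , _ , N))
    ... | deg₁ N = 0F , λ k≢0 _ → (λ q → k≢0 (trans q c≡0)) , λ { (a , _ , w∉) →
            clash x∈ (subst (λ t → Fresh t X) (trans (N₁.cover N a) (sym (N₁.cover N cx))) w∉) }
    ... | deg₂ {a} {b} N with N₂.cover N cx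
    ...   | inj₁ refl = f b , λ k≢0 k≢ξ → (λ q → k≢0 (trans q c≡0)) , λ { (p , _ , w∉) →
            [ (λ { refl → clash x∈ w∉ }) , (λ { refl → ≢⇒Compatible k≢ξ }) ]′ (N₂.cover N p) }
    ...   | inj₂ refl = f a , λ k≢0 k≢ξ → (λ q → k≢0 (trans q c≡0)) , λ { (p , _ , w∉) →
            [ (λ { refl → ≢⇒Compatible k≢ξ }) , (λ { refl → clash x∈ w∉ }) ]′ (N₂.cover N p) }

    free₂ : ∀ {X f c x q k} → N₂ G c x q → x ∈ X → f c ≡ 0F → k ≢ 0F → k ≢ f q → Free (G ∖ X) f c k
    free₂ N x∈ c≡0 k≢0 k≢q = (λ e → k≢0 (trans e c≡0)) , λ { (p , _ , w∉) →
      [ (λ { refl → clash x∈ w∉ }) , (λ { refl → ≢⇒Compatible k≢q }) ]′ (N₂.cover N p) }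

    module _ {u v w u′ v′ w′ : Fin n} (T : Tri G u v w u′ v′ w′) where
      open Tri T

      private
        X : List (Fin n)
        X = u ∷ v ∷ w ∷ []

      u≢v = ≢-adj {G = G} (N₃.va nu)
      u≢w = ≢-adj {G = G} (N₃.vb nu)
      v≢w = ≢-adj {G = G} (N₃.va nv)

      three-u : Three G u
      three-u = _ , _ , _ , nu
      three-v : Three G v
      three-v = _ , _ , _ , nv
      three-w : Three G w
      three-w = _ , _ , _ , nw

      outer-low : ¬ Three G u′
      outer-low = saturated nu three-v three-w

      outer-u : ∀ {y} → Adj u y → Fresh y X → y ≡ u′
      outer-u a (_ ∷ y≢v ∷ y≢w ∷ []) = same₃ {G = G} class nu a y≢v y≢w
      outer-v : ∀ {y} → Adj v y → Fresh y X → y ≡ v′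
      outer-v a (y≢u ∷ _ ∷ y≢w ∷ []) = same₃ {G = G} class nv a y≢w y≢u
      outer-w : ∀ {y} → Adj w y → Fresh y X → y ≡ w′
      outer-w a (y≢u ∷ y≢v ∷ _) = same₃ {G = G} class nw a y≢u y≢v

      single : ∀ {y a b} → Fresh y X → a ∈ X → b ∈ X → Adj y a → Adj y b → a ≡ b
      single y∉ (1st refl) (1st refl) p q = refl
      single y∉ (1st refl) (2nd refl) p q = ⊥-elim (u′≢v′ (trans (sym (outer-u (symm p) y∉)) (outer-v (symm q) y∉)))
      single y∉ (1st refl) (3rd refl) p q = ⊥-elim (w′≢u′ (trans (sym (outer-w (symm q) y∉)) (outer-u (symm p) y∉)))
      single y∉ (2nd refl) (1st refl) p q = ⊥-elim (u′≢v′ (trans (sym (outer-u (symm q) y∉)) (outer-v (symm p) y∉)))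
      single y∉ (2nd refl) (2nd refl) p q = refl
      single y∉ (2nd refl) (3rd refl) p q = ⊥-elim (v′≢w′ (trans (sym (outer-v (symm p) y∉)) (outer-w (symm q) y∉)))
      single y∉ (3rd refl) (1st refl) p q = ⊥-elim (w′≢u′ (trans (sym (outer-w (symm p) y∉)) (outer-u (symm q) y∉)))
      single y∉ (3rd refl) (2nd refl) p q = ⊥-elim (v′≢w′ (trans (sym (outer-v (symm q) y∉)) (outer-w (symm p) y∉)))
      single y∉ (3rd refl) (3rd refl) p q = refl

      branching : All (λ x → ∃ λ a → ∃ λ b → Adj x a × Adj x b × a ≢ b) X
      branching = (_ , _ , N₃.va nu , N₃.vb nu , N₃.a≢b nu) ∷ (_ , _ , N₃.va nv , N₃.vb nv , N₃.a≢b nv) ∷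
        (_ , _ , N₃.va nw , N₃.vb nw , N₃.a≢b nw) ∷ []

      tri-paint : ∀ H {f k l m} → H ⊑ G → Valid (H ∖ X) f → k ≢ l → k ≢ m → l ≢ m →
        Fitting H {f} X u u′ k l m → Fitting H {f} X v v′ l k m → Fitting H {f} X w w′ m k l →
        Painting H (⟨ u , k , u′ ⟩ ∷ ⟨ v , l , v′ ⟩ ∷ ⟨ w , m , w′ ⟩ ∷ []) f
      tri-paint H s V k≢l k≢m l≢m = triangle-paint H V u≢v u≢w v≢w k≢l k≢m l≢m
        (λ a → subcubic nu (s a)) (λ a → subcubic (swap₃ nv) (s a)) (λ a → subcubic nw (s a))

    outer-fresh : ∀ {u v w u′ v′ w′} → Tri G u v w u′ v′ w′ → Fresh u′ (u ∷ v ∷ w ∷ [])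
    outer-fresh (tri nu _ _ _ _ _) = ≢-sym (≢-adj {G = G} (N₃.vc nu)) ∷ ≢-sym (N₃.a≢c nu) ∷ ≢-sym (N₃.b≢c nu) ∷ []

    fresh-cycle : ∀ {y a b c : Fin n} → Fresh y (a ∷ b ∷ c ∷ []) → Fresh y (c ∷ a ∷ b ∷ [])
    fresh-cycle (p ∷ q ∷ r ∷ []) = r ∷ p ∷ q ∷ []

    -- The deletion leaves the isolated edge `v′ w′`, about which the leaf condition says nothing;
    -- but maximality puts 0 on one end. The triangle vertex at the other end takes 0, and the
    -- remaining two avoid the colour of that end.
    noLoop : ∀ {u v w u′ v′ w′} → Tri G u v w u′ v′ w′ → Adj v′ w′ → ⊥
    noLoop {u} {v} {w} {u′} {v′} {w′} T v′w′ = ih X (1st refl) (N₃.va nu) λ (f , N) → go f N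
      where
      open Tri T
      X = u ∷ v ∷ w ∷ []
      v′∉ : Fresh v′ X
      v′∉ = fresh-cycle (outer-fresh (cycle T))
      w′∉ : Fresh w′ X
      w′∉ = fresh-cycle (fresh-cycle (outer-fresh (cycle (cycle T))))
      Nv′ : N₂ G v′ v w′
      Nv′ = low (symm (N₃.vc nv)) v′w′ (λ { refl → clash (2nd refl) w′∉ }) (outer-low (cycle T))
      Nw′ : N₂ G w′ w v′
      Nw′ = low (symm (N₃.vc nw)) (symm v′w′) (λ { refl → clash (3rd refl) v′∉ }) (outer-low (cycle (cycle T)))
      v′w′-adj : Graph.Adj (G ∖ X) v′ w′
      v′w′-adj = v′w′ , v′∉ , w′∉
      second : ∀ {q} → Adj u′ q → q ≢ u → Fresh q X → ∀ {r} → Adj q r → r ∈ X → ⊥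
      second a _ q∉ b (1st refl) with outer-u T (symm b) q∉
      ... | refl = irrefl a
      second a _ q∉ b (2nd refl) with outer-v T (symm b) q∉
      ... | refl = [ (λ { refl → clash (2nd refl) (outer-fresh T) }) , ≢-sym w′≢u′ ]′ (N₂.cover Nv′ (symm a))
      second a _ q∉ b (3rd refl) with outer-w T (symm b) q∉
      ... | refl = [ (λ { refl → clash (3rd refl) (outer-fresh T) }) , u′≢v′ ]′ (N₂.cover Nw′ (symm a))
      go : ∀ f → Nice (G ∖ X) f → ⊥
      go f N with outer₀ N (1st refl) (symm (N₃.vc nu)) (outer-low T) second
      ... | u′≡0 with free₁ {X} {f} (1st refl) (symm (N₃.vc nu)) (outer-low T) u′≡0 | f v′ ≟ 0F
      ...   | ξ , free | yes v′≡0 with avoid₂ (f w′) ξ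
      ...     | k , k≢0 , k≢w′ , k≢ξ with avoid₂ (f w′) k
      ...       | l , l≢0 , l≢w′ , l≢k with tri-paint T G {f = f} {k} {l} {0F} id (Nice.valid N) (≢-sym l≢k) k≢0 l≢0
        (λ _ → free k≢0 k≢ξ , 0-compatible u′≡0 , 0-compatible u′≡0)
        (λ _ → free₂ {f = f} Nv′ (2nd refl) v′≡0 l≢0 l≢w′ , 0-compatible v′≡0 , 0-compatible v′≡0)
        (λ _ → Free-0 {G = G ∖ X} {f} refl (λ e → Nice.proper N v′w′-adj (trans v′≡0 (sym e))) ,
          ≢⇒Compatible (≢-sym k≢w′) , ≢⇒Compatible (≢-sym l≢w′))
      ...         | g , V , _ , agree = finish₂ X N V agree (branching T) (single T)
      go f N | u′≡0 | ξ , free | no v′≢0 with Nice.maximal N v′≢0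
      ...   | t , (a , _ , t∉) , t≡0 with N₂.cover Nv′ a
      ...     | inj₁ refl = clash (2nd refl) t∉
      ...     | inj₂ refl with avoid₂ (f v′) ξ
      ...       | k , k≢0 , k≢v′ , k≢ξ with avoid₂ (f v′) k
      ...         | m , m≢0 , m≢v′ , m≢k with tri-paint T G {f = f} {k} {0F} {m} id (Nice.valid N) k≢0 (≢-sym m≢k) (≢-sym m≢0)
        (λ _ → free k≢0 k≢ξ , 0-compatible u′≡0 , 0-compatible u′≡0)
        (λ _ → Free-0 {G = G ∖ X} {f} refl v′≢0 , ≢⇒Compatible (≢-sym k≢v′) , ≢⇒Compatible (≢-sym m≢v′))
        (λ _ → free₂ {f = f} Nw′ (3rd refl) t≡0 m≢0 m≢v′ , 0-compatible t≡0 , 0-compatible t≡0)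
      ...           | g , V , _ , agree = finish₂ X N V agree (branching T) (single T)

    outer-independent : ∀ {u v w u′ v′ w′} → Tri G u v w u′ v′ w′ →
      ¬ Adj u′ v′ × ¬ Adj v′ w′ × ¬ Adj w′ u′
    outer-independent T = noLoop (cycle (cycle T)) , noLoop T , noLoop (cycle T)

    noTriLeaf : ∀ {u v w u′ v′ w′} → Tri G u v w u′ v′ w′ → N₁ G u′ u → ⊥
    noTriLeaf {u} {v} {w} {u′} {v′} {w′} T Nu′ = ih X (1st refl) (N₃.va nu) λ (f , N) → go f N
      where
      open Tri T
      X = u ∷ v ∷ w ∷ []
      iso : ∀ {t} → ¬ Graph.Adj (G ∖ X) u′ t
      iso (a , _ , t∉) = All.head t∉ (N₁.cover Nu′ a)
      second-v : ∀ {q} → Adj v′ q → q ≢ v → Fresh q X → ∀ {r} → Adj q r → r ∈ X → ⊥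
      second-v a _ q∉ b (1st refl) with outer-u T (symm b) q∉
      ... | refl = proj₁ (outer-independent T) (symm a)
      second-v a _ q∉ b (2nd refl) with outer-v T (symm b) q∉
      ... | refl = irrefl a
      second-v a _ q∉ b (3rd refl) with outer-w T (symm b) q∉
      ... | refl = noLoop T a
      second-w : ∀ {q} → Adj w′ q → q ≢ w → Fresh q X → ∀ {r} → Adj q r → r ∈ X → ⊥
      second-w a _ q∉ b (1st refl) with outer-u T (symm b) q∉
      ... | refl = proj₂ (proj₂ (outer-independent T)) a
      second-w a _ q∉ b (2nd refl) with outer-v T (symm b) q∉
      ... | refl = noLoop T (symm a)
      second-w a _ q∉ b (3rd refl) with outer-w T (symm b) q∉
      ... | refl = irrefl a
      go : ∀ f → Nice (G ∖ X) f → ⊥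
      go f N with outer₀ N (2nd refl) (symm (N₃.vc nv)) (outer-low (cycle T)) second-v
                | outer₀ N (3rd refl) (symm (N₃.vc nw)) (outer-low (cycle (cycle T))) second-w
      ... | v′≡0 | w′≡0 with free₁ {X} {f} (2nd refl) (symm (N₃.vc nv)) (outer-low (cycle T)) v′≡0
                           | free₁ {X} {f} (3rd refl) (symm (N₃.vc nw)) (outer-low (cycle (cycle T))) w′≡0
      -- Nothing nonzero is forbidden at `u`, as `u′` is isolated with colour 0. The artificial
      -- constraint `κ` differs from `ξ` to satisfy the hypothesis of `rainbow!`.
      ...   | ξ , free-v | ζ , free-w with avoid₂ ξ ξ
      ...     | κ , _ , κ≢ξ , _ with rainbow! κ ξ ζ (λ e → κ≢ξ (proj₁ e))
      ...       | rainbow α β γ α≢0 β≢0 γ≢0 α≢β α≢γ β≢γ _ β≢ξ γ≢ζ with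
        tri-paint T G {f = f} id (Nice.valid N) α≢β α≢γ β≢γ
        (λ _ → Free-isolated {G = G ∖ X} iso (quiet N iso) α≢0 , 0-compatible (quiet N iso) , 0-compatible (quiet N iso))
        (λ _ → free-v β≢0 β≢ξ , 0-compatible v′≡0 , 0-compatible v′≡0)
        (λ _ → free-w γ≢0 γ≢ζ , 0-compatible w′≡0 , 0-compatible w′≡0)
      ...         | g , V , _ , agree = finish₂ X N V agree (branching T) (single T)

    noLeaf : ∀ {x y} → N₁ G x y → ⊥
    noLeaf Nx with last₃ {G = G} class (leaf-support Nx) (symm (N₁.va Nx))
    ... | a , b , Ny with triangle Ny
    ...   | inj₂ (inj₁ ax) = ≢-adj {G = G} (N₃.va Ny) (sym (N₁.cover Nx (symm ax)))
    ...   | inj₂ (inj₂ bx) = ≢-adj {G = G} (N₃.vb Ny) (sym (N₁.cover Nx (symm bx)))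
    ...   | inj₁ ab with shape Ny ab
    ...     | is-hat (hat ny nz nx _) = noHatLeaf Nx ny nz nx
    ...     | is-tri T = noTriLeaf T Nx

    two-or-three : ∀ {v a} → Adj v a → (∃ λ b → N₂ G v a b) ⊎ Three G v
    two-or-three {v} p with degree {G = G} v
    ... | deg₀ h = ⊥-elim (h p)
    ... | deg₁ N = ⊥-elim (noLeaf N)
    ... | deg₃ N = inj₂ (_ , _ , _ , N)
    ... | deg₂ N with N₂.cover N p
    ...   | inj₁ refl = inj₁ (_ , N)
    ...   | inj₂ refl = inj₁ (_ , swap₂ N)

    -- Without leaves of degree 1 the leaf condition concerns isolated vertices only. `X` lists the
    -- recoloured vertices and may exceed the deleted set `Y`.
    finish₃ : ∀ X {Y f g} → Nice (G ∖ Y) f → Valid G g → All (λ x → ∃ (Adj x)) X →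
      (∀ {z} → Fresh z X → g z ≡ f z) → ⊥
    finish₃ X {g = g} N V touched agree = bad (g , V , leafy)
      where
      leafy : Leafy G g
      leafy {x} l with degree {G = G} x
      ... | deg₁ N = ⊥-elim (noLeaf N)
      ... | deg₂ N = ¬leaf {G = G} (N₂.va N) (N₂.vb N) (N₂.a≢b N) l
      ... | deg₃ N = ¬leaf {G = G} (N₃.va N) (N₃.vb N) (N₃.a≢b N) l
      ... | deg₀ h with fresh? x X
      ...   | inj₁ x∈ = ⊥-elim (h (proj₂ (All.lookup touched x∈)))
      ...   | inj₂ x∉ = inj₁ (trans (agree x∉) (quiet N λ (a , _) → h a))

-- Paths of three vertices of degree 2, and hats

module Hats {n : ℕ} {G : Graph n} (M : Minimal G) where
  open Graph G renaming (sym to symm)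
  open Minimal M
  open Class class
  open Sparse M
  open Triangles M

  ¬three : ∀ {v a b} → N₂ G v a b → ¬ Three G v
  ¬three N = two≢three {G = G} N

  -- Deleting `y` and `z` makes `y′` a leaf, of colour 0 by `outer₀` unless `y″` is `z′`. In that
  -- four-cycle a nonzero `y′` has its 0-neighbour at `z′`, and `y` can take 0.
  noPath : ∀ {y y′ y″ z z′} → N₂ G y y′ z → N₂ G z y z′ → N₂ G y′ y y″ → ⊥
  noPath {y} {y′} {y″} {z} {z′} Ny Nz Ny′ with y′ ≟ z′
  ... | yes refl with N₂.cover Ny′ (symm (N₂.vb Nz))
  ...   | inj₁ refl = irrefl (N₂.va Nz)
  -- The component is a triangle; `c` is a dummy.
  ...   | inj₂ refl = noTwins {c = y} (N₂.va Ny) (N₂.vb Ny) Ny′ Nz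
            λ a → [ inj₁ , (λ e → inj₂ (inj₁ e)) ]′ (N₂.cover Ny a)
  noPath {y} {y′} {y″} {z} {z′} Ny Nz Ny′ | no y′≢z′ = ih X (1st refl) (N₂.va Ny) λ (f , N) → go f N
    where
    X = y ∷ z ∷ []
    touched : All (λ x → ∃ (Adj x)) X
    touched = (_ , N₂.va Ny) ∷ (_ , N₂.va Nz) ∷ []
    colourable : ∀ {f k l} → Nice (G ∖ X) f → k ≢ l → Free (G ∖ X) f y′ k → Free (G ∖ X) f z′ l →
      Compatible (f y′) l → Compatible (f z′) k → ⊥
    colourable {f} {k} {l} N k≢l fy fz cy cz with extend-paint {G = G} (⟨ y , k , y′ ⟩ ∷ ⟨ z , l , z′ ⟩ ∷ []) (Nice.valid N)
      (((≢-adj {G = G} (N₂.vb Ny) , k≢l , (λ _ → cy) , (λ _ → cz)) ∷ []) ∷ [] ∷ [])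
      ((λ a → [ inj₂ , (λ e → inj₁ (2nd e)) ]′ (N₂.cover Ny a)) ∷
       (λ a → [ (λ e → inj₁ (1st e)) , inj₂ ]′ (N₂.cover Nz a)) ∷ [])
      ((λ _ → fy) ∷ (λ _ → fz) ∷ [])
    ... | g , V , _ , agree = finish₃ X N V touched agree
    y′∉ : Fresh y′ X
    y′∉ = ≢-sym (≢-adj {G = G} (N₂.va Ny)) ∷ N₂.a≢b Ny ∷ []
    z′∉ : Fresh z′ X
    z′∉ = ≢-sym (N₂.a≢b Nz) ∷ ≢-sym (≢-adj {G = G} (N₂.vb Nz)) ∷ []
    zero-end : ∀ {f} → Nice (G ∖ X) f → f y′ ≡ 0F → ⊥
    zero-end {f} N y′≡0 with spare class N (2nd refl) (symm (N₂.vb Nz)) | f z′ ≟ 0F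
    ... | γ , γ≢0 , free | yes z′≡0 with avoid₂ (f y″) γ
    ...   | k , k≢0 , k≢y″ , k≢γ = colourable {f} N k≢γ (free₂ {f = f} Ny′ (1st refl) y′≡0 k≢0 k≢y″) free
            (0-compatible y′≡0) (0-compatible z′≡0)
    zero-end {f} N y′≡0 | _ | no z′≢0 with avoid₂ (f y″) (f z′)
    ...   | k , k≢0 , k≢y″ , k≢z′ = colourable {f} N k≢0 (free₂ {f = f} Ny′ (1st refl) y′≡0 k≢0 k≢y″)
            (Free-0 {G = G ∖ X} {f} refl z′≢0) (0-compatible y′≡0) (≢⇒Compatible (≢-sym k≢z′))
    go : ∀ f → Nice (G ∖ X) f → ⊥
    go f N with y″ ≟ z′ | f y′ ≟ 0F
    ... | _ | yes y′≡0 = zero-end N y′≡0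
    ... | yes refl | no y′≢0 with Nice.maximal N y′≢0 | spare class N (2nd refl) (symm (N₂.vb Nz))
    ...   | t , (a , _ , t∉) , t≡0 | γ , γ≢0 , free with N₂.cover Ny′ a
    ...     | inj₁ refl = clash (1st refl) t∉
    ...     | inj₂ refl = colourable {f} N (≢-sym γ≢0) (Free-0 {G = G ∖ X} {f} refl y′≢0) free
                (≢⇒Compatible λ e → γ≢0 (proj₂ free (symm (N₂.vb Ny′) , z′∉ , y′∉) (sym e)))
                (0-compatible t≡0)
    go f N | no y″≢z′ | no y′≢0 = y′≢0 (outer₀ N (1st refl) (N₂.va Ny′) (¬three Ny′) second)
      where
      second : ∀ {q} → Adj y′ q → q ≢ y → Fresh q X → ∀ {r} → Adj q r → r ∈ X → ⊥
      second a q≢y q∉ b r∈ with N₂.cover Ny′ a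
      ... | inj₁ e = q≢y e
      second a q≢y q∉ b (1st refl) | inj₂ refl with N₂.cover Ny (symm b)
      ... | inj₁ refl = irrefl a
      ... | inj₂ refl = clash (2nd refl) q∉
      second a q≢y q∉ b (2nd refl) | inj₂ refl = [ q≢y , y″≢z′ ]′ (N₂.cover Nz (symm b))

  hat-touched : ∀ {y z x y′ z′} → Hat G y z x y′ z′ → All (λ x → ∃ (Adj x)) (y ∷ z ∷ x ∷ [])
  hat-touched (hat ny nz nx _) = (_ , N₃.va ny) ∷ (_ , N₃.va nz) ∷ (_ , N₂.va nx) ∷ []

  hat-paint : ∀ {y z x y′ z′ f k l m} (H : Hat G y z x y′ z′) → let X = y ∷ z ∷ x ∷ [] in
    Valid (G ∖ X) f → k ≢ l → k ≢ m → l ≢ m →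
    Free (G ∖ X) f y′ k → Free (G ∖ X) f z′ l → Compatible (f y′) l → Compatible (f y′) m →
    Compatible (f z′) k → Compatible (f z′) m → Painting G (⟨ y , k , y′ ⟩ ∷ ⟨ z , l , z′ ⟩ ∷ ⟨ x , m , x ⟩ ∷ []) f
  hat-paint {x = x} (hat ny nz nx _) V k≢l k≢m l≢m fy fz yl ym zk zm =
    triangle-paint G V (≢-adj {G = G} (N₃.va ny)) (≢-adj {G = G} (N₃.vb ny)) (≢-adj {G = G} (N₃.vb nz))
      k≢l k≢m l≢m (subcubic ny) (subcubic nz) (λ a → [ inj₁ , (λ e → inj₂ (inj₁ e)) ]′ (N₂.cover nx a))
      (λ _ → fy , yl , ym) (λ _ → fz , zk , zm) (absurd {v = x})

  -- The dichotomy of `noPath` again: either `y′` has colour 0, or `y″` is `z′` and maximality puts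
  -- the 0 there. The apex takes a colour left over.
  noHatPath : ∀ {y z x y′ z′ y″} → Hat G y z x y′ z′ → N₂ G y′ y y″ → ⊥
  noHatPath {y} {z} {x} {y′} {z′} {y″} H@(hat ny nz nx y′≢z′) Ny′ = ih X (1st refl) (N₃.va ny) λ (f , N) → go f N
    where
    X = y ∷ z ∷ x ∷ []
    y′∉ : Fresh y′ X
    y′∉ = ≢-sym (≢-adj {G = G} (N₃.vc ny)) ∷ ≢-sym (N₃.a≢c ny) ∷ ≢-sym (N₃.b≢c ny) ∷ []
    z′∉ : Fresh z′ X
    z′∉ = ≢-sym (N₃.a≢c nz) ∷ ≢-sym (≢-adj {G = G} (N₃.vc nz)) ∷ ≢-sym (N₃.b≢c nz) ∷ []
    zero-end : ∀ {f} → Nice (G ∖ X) f → f y′ ≡ 0F → ⊥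
    zero-end {f} N y′≡0 with spare class N (2nd refl) (symm (N₃.vc nz)) | f z′ ≟ 0F
    ... | γ , γ≢0 , free | yes z′≡0 with avoid₂ (f y″) γ
    ...   | k , k≢0 , k≢y″ , k≢γ with hat-paint {f = f} H (Nice.valid N) k≢γ k≢0 γ≢0
              (free₂ {f = f} Ny′ (1st refl) y′≡0 k≢0 k≢y″) free
              (0-compatible y′≡0) (0-compatible y′≡0) (0-compatible z′≡0) (0-compatible z′≡0)
    ...     | g , V , _ , agree = finish₃ X N V (hat-touched H) agree
    zero-end {f} N y′≡0 | _ | no z′≢0 with avoid₂ (f y″) (f z′)
    ...   | k , k≢0 , k≢y″ , k≢z′ with avoid₂ k (f z′)
    ...     | m , m≢0 , m≢k , m≢z′ with hat-paint {f = f} H (Nice.valid N) k≢0 (≢-sym m≢k) (≢-sym m≢0)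
              (free₂ {f = f} Ny′ (1st refl) y′≡0 k≢0 k≢y″) (Free-0 {G = G ∖ X} {f} refl z′≢0)
              (0-compatible y′≡0) (0-compatible y′≡0) (≢⇒Compatible (≢-sym k≢z′)) (≢⇒Compatible (≢-sym m≢z′))
    ...       | g , V , _ , agree = finish₃ X N V (hat-touched H) agree
    go : ∀ f → Nice (G ∖ X) f → ⊥
    go f N with y″ ≟ z′ | f y′ ≟ 0F
    ... | _ | yes y′≡0 = zero-end N y′≡0
    ... | yes refl | no y′≢0 with Nice.maximal N y′≢0 | spare class N (2nd refl) (symm (N₃.vc nz))
    ...   | t , (a , _ , t∉) , t≡0 | γ , γ≢0 , free with N₂.cover Ny′ a
    ...     | inj₁ refl = clash (1st refl) t∉
    ...     | inj₂ refl with avoid₂ (f y′) γ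
    ...       | m , m≢0 , m≢y′ , m≢γ with hat-paint {f = f} H (Nice.valid N) (≢-sym γ≢0) (≢-sym m≢0) (≢-sym m≢γ)
                (Free-0 {G = G ∖ X} {f} refl y′≢0) free
                (≢⇒Compatible λ e → γ≢0 (proj₂ free (symm (N₂.vb Ny′) , z′∉ , y′∉) (sym e)))
                (≢⇒Compatible (≢-sym m≢y′)) (0-compatible t≡0) (0-compatible t≡0)
    ...         | g , V , _ , agree = finish₃ X N V (hat-touched H) agree
    go f N | no y″≢z′ | no y′≢0 = y′≢0 (outer₀ N (1st refl) (N₂.va Ny′) (¬three Ny′) second)
      where
      second : ∀ {q} → Adj y′ q → q ≢ y → Fresh q X → ∀ {r} → Adj q r → r ∈ X → ⊥
      second a q≢y q∉ b r∈ with N₂.cover Ny′ a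
      ... | inj₁ e = q≢y e
      second a q≢y q∉ b (1st refl) | inj₂ refl with same₃ {G = G} class ny (symm b) (All.head (All.tail q∉)) (All.head (All.tail (All.tail q∉)))
      ... | refl = irrefl a
      second a q≢y q∉ b (2nd refl) | inj₂ refl =
        y″≢z′ (same₃ {G = G} class nz (symm b) q≢y (All.head (All.tail (All.tail q∉))))
      second a q≢y q∉ b (3rd refl) | inj₂ refl = [ q≢y , All.head (All.tail q∉) ]′ (N₂.cover nx (symm b))

  outer-three : ∀ {y z x y′ z′} → Hat G y z x y′ z′ → Three G y′
  outer-three H@(hat ny _ _ _) with two-or-three (symm (N₃.vc ny))
  ... | inj₁ (_ , N) = ⊥-elim (noHatPath H N)
  ... | inj₂ t = t

  -- A common neighbour of `y` and `y′` would be `x` or `z`, but `x` has no further neighbour and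
  -- the third one of `z` is `z′`. Hence the triangle at `y′` avoids `y`.
  apex : ∀ {y z x y′ z′ a} {A : Set} → Hat G y z x y′ z′ → Adj y′ a → Adj a y → A
  apex (hat ny nz nx y′≢z′) p q with subcubic ny (symm q)
  ... | inj₂ (inj₂ refl) = ⊥-elim (irrefl p)
  ... | inj₂ (inj₁ refl) with N₂.cover nx (symm p)
  ...   | inj₁ refl = ⊥-elim (irrefl (N₃.vc ny))
  ...   | inj₂ refl = ⊥-elim (N₃.a≢c ny refl)
  apex (hat ny nz nx y′≢z′) p q | inj₁ refl with subcubic nz (symm p)
  ... | inj₁ refl = ⊥-elim (irrefl (N₃.vc ny))
  ... | inj₂ (inj₁ refl) = ⊥-elim (N₃.b≢c ny refl)
  ... | inj₂ (inj₂ e) = ⊥-elim (y′≢z′ e)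

  outer-hat : ∀ {y z x y′ z′} → Hat G y z x y′ z′ → ∃ λ m → ∃ λ h → ∃ λ m′ → Hat G y′ m h y m′
  outer-hat H@(hat ny _ _ _) with last₃ {G = G} class (outer-three H) (symm (N₃.vc ny))
  ... | a , b , N with triangle N
  ...   | inj₂ (inj₁ q) = apex H (N₃.va N) q
  ...   | inj₂ (inj₂ q) = apex H (N₃.vb N) q
  ...   | inj₁ ab with shape N ab
  ...     | is-hat H′ = _ , _ , _ , H′
  -- `y` would be an outer neighbour of a triangle with three vertices of degree 3, but it has
  -- degree 3 itself.
  ...     | is-tri T = ⊥-elim (outer-low T (_ , _ , _ , ny))

  hat-fresh : ∀ {y z x y′ z′ m h m′} → Hat G y z x y′ z′ → Hat G y′ m h y m′ →
    Fresh y′ (y ∷ z ∷ x ∷ []) × Fresh h (y ∷ z ∷ x ∷ []) × Fresh m (y ∷ z ∷ x ∷ [])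
  hat-fresh {y} {z} {x} {y′} {z′} {m} {h} H@(hat ny nz nx y′≢z′) (hat ny′ nm nh _) =
    (≢-sym (≢-adj {G = G} (N₃.vc ny)) ∷ ≢-sym (N₃.a≢c ny) ∷ ≢-sym (N₃.b≢c ny) ∷ []) ,
    away (N₃.vb ny′) (≢-sym (N₃.b≢c ny′)) , away (N₃.va ny′) (≢-sym (N₃.a≢c ny′))
    where
    away : ∀ {t} → Adj y′ t → y ≢ t → Fresh t (y ∷ z ∷ x ∷ [])
    away p y≢t = ≢-sym y≢t ∷ (λ { refl → apex H p (N₃.va nz) }) ∷ (λ { refl → apex H p (N₂.va nx) }) ∷ []

  module _ {y z x y′ z′ : Fin n} (H : Hat G y z x y′ z′) where
    open Hat H

    private
      X : List (Fin n)
      X = y ∷ z ∷ x ∷ []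

      K : Graph n
      K = G ∖ X

    -- `noHat` exchanges twins at `y′` and `z′` independently, so these must belong to different
    -- hats. If not, the other hat is left as a triangle component; an exchange puts 0 on `z′`, and
    -- `x` can repeat the colour of `h`.
    noRing : ∀ {h m′} → Hat G y′ z′ h y m′ → ⊥
    noRing {h} H₁@(hat ny′ nz′ nh _) = ih X (1st refl) (N₃.va ny) λ (f , N) → go f N
      where
      y′∉ = proj₁ (hat-fresh H H₁)
      h∉ = proj₁ (proj₂ (hat-fresh H H₁))
      z′∉ = proj₂ (proj₂ (hat-fresh H H₁))
      y′z′ : Graph.Adj K y′ z′
      y′z′ = N₃.va ny′ , y′∉ , z′∉
      y′h : Graph.Adj K y′ h
      y′h = N₃.vb ny′ , y′∉ , h∉
      z′h : Graph.Adj K z′ h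
      z′h = N₃.vb nz′ , z′∉ , h∉
      cover-y′ : ∀ {t} → Graph.Adj K y′ t → t ≡ z′ ⊎ t ≡ h
      cover-y′ (a , _ , t∉) = [ inj₁ , [ inj₂ , (λ { refl → clash (1st refl) t∉ }) ]′ ]′ (subcubic ny′ a)
      m′≡z : ∀ {t} → Adj z′ t → t ≡ y′ ⊎ t ≡ h ⊎ t ≡ z
      m′≡z {t} a with t ≟ y′ | t ≟ h
      ... | yes e | _ = inj₁ e
      ... | _ | yes e = inj₂ (inj₁ e)
      ... | no p | no q = inj₂ (inj₂ (trans (same₃ {G = G} class nz′ a p q)
              (sym (same₃ {G = G} class nz′ (symm (N₃.vc nz)) (N₃.a≢c ny) λ { refl → clash (2nd refl) h∉ }))))
      cover-z′ : ∀ {t} → Graph.Adj K z′ t → t ≡ y′ ⊎ t ≡ h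
      cover-z′ (a , _ , t∉) = [ inj₁ , [ inj₂ , (λ { refl → clash (2nd refl) t∉ }) ]′ ]′ (m′≡z a)
      cover-h : ∀ {t} → Graph.Adj K h t → t ≡ y′ ⊎ t ≡ z′
      cover-h (a , _) = N₂.cover nh a
      S : List (Fin n)
      S = X ++ y′ ∷ h ∷ z′ ∷ []
      touched : All (λ x → ∃ (Adj x)) S
      touched = ++⁺ (hat-touched H) ((_ , N₃.va ny′) ∷ (_ , N₂.va nh) ∷ (_ , N₃.va nz′) ∷ [])
      zero-z′ : ∀ {f} → Nice K f → ∃ λ g → Valid K g × g z′ ≡ 0F ×
        (∀ {t} → Fresh t (y′ ∷ h ∷ z′ ∷ []) → g t ≡ f t)
      zero-z′ {f} N with f z′ ≟ 0F
      ... | yes e = f , Nice.valid N , e , λ _ → refl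
      ... | no z′≢0 with Nice.maximal N z′≢0
      ...   | t , a , t≡0 with cover-z′ a
      ...     | inj₁ refl with Twins.swap-twins K {f} {z′} {y′} {h} (Nice.valid N) (Graph.sym K y′z′) z′h y′h cover-z′ cover-y′
      ...       | g , V , e , _ , agree = g , V , trans e t≡0 , λ { (p ∷ _ ∷ q ∷ []) → agree (q ∷ p ∷ []) }
      zero-z′ {f} N | no z′≢0 | t , a , t≡0 | inj₂ refl
        with Twins.swap-twins K {f} {z′} {h} {y′} (Nice.valid N) z′h (Graph.sym K y′z′) (Graph.sym K y′h)
          (λ b → [ inj₂ , inj₁ ]′ (cover-z′ b)) (λ b → [ inj₂ , inj₁ ]′ (cover-h b))
      ...       | g , V , e , _ , agree = g , V , trans e t≡0 , λ { (_ ∷ p ∷ q ∷ []) → agree (q ∷ p ∷ []) }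
      go : ∀ f → Nice K f → ⊥
      go f N with zero-z′ N
      ... | g , V , z′≡0 , agree with avoid₂ (g y′) (g h)
      ...   | ζ , ζ≢0 , ζ≢y′ , ζ≢h with hat-paint {f = g} {0F} {ζ} {g h} H V (≢-sym ζ≢0)
                (λ e → Valid.proper V z′h (trans z′≡0 e)) ζ≢h
                (Free-0 {G = K} {g} refl (λ e → Valid.proper V y′z′ (trans e (sym z′≡0))))
                ((λ e → ζ≢0 (trans e z′≡0)) , λ a → ≢⇒Compatible λ e →
                  [ (λ { refl → ζ≢y′ e }) , (λ { refl → ζ≢h e }) ]′ (cover-z′ a))
                (≢⇒Compatible (≢-sym ζ≢y′)) (≢⇒Compatible (Valid.proper V y′h))
                (0-compatible z′≡0) (0-compatible z′≡0)
      ...     | g₂ , V₂ , _ , agree₂ = finish₃ S N V₂ touched λ t∉ → trans (agree₂ (++⁻ˡ X t∉)) (agree (++⁻ʳ X t∉))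

    -- The colours of the two twins of a neighbouring hat may be exchanged, so its outer vertex can avoid any colour.
    choose : ∀ {e h m s s′ f γ} → Hat G e m h s s′ → s ∈ X → Fresh e X → Fresh h X → Fresh m X → Valid K f →
      γ ≢ f e → γ ≢ f h → γ ≢ f m → ∀ κ → ∃ λ g → Valid K g × g e ≢ κ × Free K g e γ ×
      (∀ {t} → Fresh t (e ∷ h ∷ []) → g t ≡ f t)
    choose {e} {h} {m} {f = f} {γ} (hat ne nm nh _) s∈ e∉ h∉ m∉ V γ≢e γ≢h γ≢m κ with f e ≟ κ
    ... | no e≢κ = f , V , e≢κ , (γ≢e , λ a → ≢⇒Compatible λ q →
            [ (λ { refl → γ≢m q }) , (λ { refl → γ≢h q }) ]′ (cover-e a)) , λ _ → refl
      where
      cover-e : ∀ {t} → Graph.Adj K e t → t ≡ m ⊎ t ≡ h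
      cover-e (a , _ , t∉) = [ inj₁ , [ inj₂ , (λ { refl → clash s∈ t∉ }) ]′ ]′ (subcubic ne a)
    ... | yes refl with Twins.swap-twins K {f} {e} {h} {m} V (N₃.vb ne , e∉ , h∉) (N₃.va ne , e∉ , m∉) (N₂.vb nh , h∉ , m∉)
          (λ { (a , _ , t∉) → [ inj₂ , [ inj₁ , (λ { refl → clash s∈ t∉ }) ]′ ]′ (subcubic ne a) })
          (λ { (a , _) → N₂.cover nh a })
    ...   | g , W , ge , gh , agree = g , W , (λ q → Valid.proper V (N₃.vb ne , e∉ , h∉) (trans (sym q) ge)) ,
            ((λ q → γ≢h (trans q ge)) , λ { (a , _ , t∉) → ≢⇒Compatible λ q →
              [ (λ { refl → γ≢m (trans q (agree (≢-sym (≢-adj {G = G} (N₃.va ne)) ∷ ≢-sym (≢-adj {G = G} (N₂.vb nh)) ∷ []))) }) ,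
                [ (λ { refl → γ≢e (trans q gh) }) , (λ { refl → clash s∈ t∉ }) ]′ ]′ (subcubic ne a) }) , agree

  noHat : ∀ {y z x y′ z′} → Hat G y z x y′ z′ → ⊥
  noHat {y} {z} {x} {y′} {z′} H with outer-hat H | outer-hat (flip-hat H)
  ... | m , h , m′ , H₁ | p , g , p′ , H₂ with m ≟ z′
  ...   | yes refl = noRing H H₁
  ...   | no m≢z′ = ih X (1st refl) (N₃.va ny) λ (f , N) → go f N
    where
    open Hat H
    X = y ∷ z ∷ x ∷ []
    K = G ∖ X
    module H₁ = Hat H₁
    module H₂ = Hat H₂
    y′∉ˣ = proj₁ (hat-fresh H H₁)
    h∉ = proj₁ (proj₂ (hat-fresh H H₁))
    m∉ = proj₂ (proj₂ (hat-fresh H H₁))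
    turn : ∀ {t} → Fresh t (z ∷ y ∷ x ∷ []) → Fresh t X
    turn (a ∷ b ∷ c) = b ∷ a ∷ c
    z′∉ˣ = turn (proj₁ (hat-fresh (flip-hat H) H₂))
    g∉ = turn (proj₁ (proj₂ (hat-fresh (flip-hat H) H₂)))
    p∉ = turn (proj₂ (proj₂ (hat-fresh (flip-hat H) H₂)))
    z′≢h : z′ ≢ h
    z′≢h refl = ¬three H₁.nx (_ , _ , _ , H₂.ny)
    y′≢g : y′ ≢ g
    y′≢g refl = ¬three H₂.nx (_ , _ , _ , H₁.ny)
    h≢g : h ≢ g
    h≢g refl = [ ≢-sym y′≢z′ , (λ e → m≢z′ (sym e)) ]′ (N₂.cover H₁.nx (N₂.va H₂.nx))
    p≢y′ : p ≢ y′
    p≢y′ refl = [ (λ e → m≢z′ (sym e)) , [ z′≢h , (λ e → N₃.a≢c nz (sym e)) ]′ ]′ (subcubic H₁.ny (symm (N₃.va H₂.ny)))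
    p≢h : p ≢ h
    p≢h refl = ¬three H₁.nx (_ , _ , _ , H₂.nz)
    m≢g : m ≢ g
    m≢g refl = ¬three H₂.nx (_ , _ , _ , H₁.nz)
    S : List (Fin n)
    S = X ++ (y′ ∷ h ∷ []) ++ (z′ ∷ g ∷ [])
    touched : All (λ x → ∃ (Adj x)) S
    touched = ++⁺ (hat-touched H) ((_ , N₃.va H₁.ny) ∷ (_ , N₂.va H₁.nx) ∷ (_ , N₃.va H₂.ny) ∷ (_ , N₂.va H₂.nx) ∷ [])
    module _ {f : Fin n → Colour} (N : Nice K f) where
      -- `κ′` is a function because the colour kept away from `z′` may depend on the colour that
      -- `y′` ends up with.
      Spread : Colour → Colour → Colour → (Colour → Colour) → Set
      Spread γ δ κ κ′ = ∃ λ j → Valid K j × j y′ ≢ κ × j z′ ≢ κ′ (j y′) × Free K j y′ γ × Free K j z′ δ ×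
        (∀ {t} → Fresh t ((y′ ∷ h ∷ []) ++ (z′ ∷ g ∷ [])) → j t ≡ f t)
      nonzero-free : ∀ {c k t} → k ≢ 0F → Free K f c k → Graph.Adj K c t → k ≢ f t
      nonzero-free k≢0 (_ , q) a e = k≢0 (q a e)
      spread : ∀ {γ δ} → γ ≢ 0F → δ ≢ 0F → Free K f y′ γ → Free K f z′ δ → ∀ κ κ′ → Spread γ δ κ κ′
      spread {γ} {δ} γ≢0 δ≢0 fy fz κ κ′ with choose H {f = f} H₁ (1st refl) y′∉ˣ h∉ m∉ (Nice.valid N) (proj₁ fy)
          (nonzero-free {c = y′} γ≢0 fy (N₃.vb H₁.ny , y′∉ˣ , h∉)) (nonzero-free {c = y′} γ≢0 fy (N₃.va H₁.ny , y′∉ˣ , m∉)) κ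
      ... | g₁ , V₁ , ne₁ , free₁ , agree₁ with choose H {f = g₁} {γ = δ} H₂ (2nd refl) z′∉ˣ g∉ p∉ V₁
          (λ e → proj₁ fz (trans e (agree₁ (≢-sym y′≢z′ ∷ z′≢h ∷ []))))
          (λ e → nonzero-free {c = z′} δ≢0 fz (N₃.vb H₂.ny , z′∉ˣ , g∉) (trans e (agree₁ (≢-sym y′≢g ∷ ≢-sym h≢g ∷ []))))
          (λ e → nonzero-free {c = z′} δ≢0 fz (N₃.va H₂.ny , z′∉ˣ , p∉) (trans e (agree₁ (p≢y′ ∷ p≢h ∷ []))))
          (κ′ (g₁ y′))
      ...   | g₂ , V₂ , ne₂ , free₂ , agree₂ =
        g₂ , V₂ , (λ e → ne₁ (trans (sym same) e)) , (λ e → ne₂ (trans e (cong κ′ same))) ,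
        Free-cong {G = K} {g₁} {g₂} (sym same) (λ a → sym (near a)) free₁ , free₂ ,
        λ t∉ → trans (agree₂ (++⁻ʳ (y′ ∷ h ∷ []) t∉)) (agree₁ (++⁻ˡ (y′ ∷ h ∷ []) t∉))
        where
        same : g₂ y′ ≡ g₁ y′
        same = agree₂ (y′≢z′ ∷ y′≢g ∷ [])
        near : ∀ {t} → Graph.Adj K y′ t → g₂ t ≡ g₁ t
        near (a , _ , t∉) with subcubic H₁.ny a
        ... | inj₁ refl = agree₂ (m≢z′ ∷ m≢g ∷ [])
        ... | inj₂ (inj₁ refl) = agree₂ (≢-sym z′≢h ∷ h≢g ∷ [])
        ... | inj₂ (inj₂ refl) = clash (1st refl) t∉
    go : ∀ f → Nice K f → ⊥
    go f N with spare class N (1st refl) (symm (N₃.vc ny)) | spare class N (2nd refl) (symm (N₃.vc nz))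
    ... | γ , γ≢0 , fy | δ , δ≢0 , fz with γ ≟ δ
    -- `y` and `z` take their spare colours and `x` takes 0; it remains to keep `y′` off `δ` and
    -- `z′` off `γ`, at distance two.
    ...   | no γ≢δ with spread N γ≢0 δ≢0 fy fz δ (λ _ → γ)
    ...     | j , V , y′≢δ , z′≢γ , jy , jz , agree with hat-paint {f = j} H V γ≢δ γ≢0 δ≢0 jy jz
                (≢⇒Compatible y′≢δ) (compatible-0 refl) (≢⇒Compatible z′≢γ) (compatible-0 refl)
    ...       | _ , V₂ , _ , agree₂ = finish₃ S N V₂ touched λ t∉ → trans (agree₂ (++⁻ˡ X t∉)) (agree (++⁻ʳ X t∉))
    -- Only `z` can take the common spare colour. `y` takes 0, so `y′` must be nonzero; `x` takes
    -- the nonzero colour different from `γ` and that of `y′`, which `z′` must not have.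
    go f N | γ , γ≢0 , fy | .γ , _ , fz | yes refl with spread N γ≢0 γ≢0 fy fz 0F (λ σ → proj₁ (avoid₂ σ γ))
    ...     | j , V , y′≢0 , z′≢τ , jy , jz , agree with avoid₂ (j y′) γ
    ...       | τ , τ≢0 , τ≢σ , τ≢γ with hat-paint {f = j} {0F} {γ} {τ} H V (≢-sym γ≢0) (≢-sym τ≢0) (≢-sym τ≢γ)
                (Free-0 {G = K} {j} refl y′≢0) jz (≢⇒Compatible (≢-sym (proj₁ jy))) (≢⇒Compatible (≢-sym τ≢σ))
                (compatible-0 refl) (≢⇒Compatible z′≢τ)
    ...         | _ , V₂ , _ , agree₂ = finish₃ S N V₂ touched λ t∉ → trans (agree₂ (++⁻ˡ X t∉)) (agree (++⁻ʳ X t∉))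

-- Threads between triangles

module Threads {n : ℕ} {G : Graph n} (M : Minimal G) where
  open Graph G renaming (sym to symm)
  open Minimal M
  open Class class
  open Sparse M
  open Triangles M
  open Hats M

  tri-at : ∀ {v a b c} → N₃ G v a b c → Adj a b → ∃ λ p → ∃ λ q → ∃ λ p′ → ∃ λ q′ → Tri G v p q c p′ q′
  tri-at N ab with shape N ab
  ... | is-hat H = ⊥-elim (noHat H)
  ... | is-tri T = _ , _ , _ , _ , T

  low≢three : ∀ {v w} → ¬ Three G v → Three G w → v ≢ w
  low≢three ¬3 t refl = ¬3 t

  tri-apex : ∀ {u v w u′ v′ w′ a} {A : Set} → Tri G u v w u′ v′ w′ → Adj u′ a → Adj a u → A
  tri-apex T@(tri nu nv nw u′≢v′ _ w′≢u′) p q with subcubic nu (symm q) | outer-fresh T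
  ... | inj₁ refl | u∉@(≢u ∷ _ ∷ ≢w ∷ []) = ⊥-elim (u′≢v′ (same₃ {G = G} class nv (symm p) ≢w ≢u))
  ... | inj₂ (inj₁ refl) | u∉@(≢u ∷ ≢v ∷ _) = ⊥-elim (w′≢u′ (sym (same₃ {G = G} class nw (symm p) ≢u ≢v)))
  ... | inj₂ (inj₂ refl) | _ = ⊥-elim (irrefl p)

  data Thread (u u′ : Fin n) : Set where
    short : ∀ {q} → N₂ G u′ u q → Three G q → Thread u u′
    long  : ∀ {q r} → N₂ G u′ u q → N₂ G q u′ r → Three G r → Thread u u′

  thread : ∀ {u v w u′ v′ w′} → Tri G u v w u′ v′ w′ → Thread u u′
  thread T with two-or-three (symm (N₃.vc (Tri.nu T)))
  ... | inj₂ t = ⊥-elim (outer-low T t)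
  ... | inj₁ (q , N) with two-or-three (symm (N₂.vb N))
  ...   | inj₂ t = short N t
  ...   | inj₁ (r , N′) with two-or-three (symm (N₂.vb N′))
  ...     | inj₂ t = long N N′ t
  ...     | inj₁ (_ , N″) = ⊥-elim (noPath N′ N″ (swap₂ N))

  outer₂ : ∀ {u v w u′ v′ w′} → Tri G u v w u′ v′ w′ → ∃ λ q → N₂ G u′ u q
  outer₂ T with thread T
  ... | short N _ = _ , N
  ... | long N _ _ = _ , N

  pattern 5th e = there (4th e)
  pattern 6th e = there (5th e)
  pattern 7th e = there (6th e)

  -- While `q` is missing, `p` hangs on `o` alone, so only the conditions at `o` count.
  attach : ∀ {Y p o q k f} → Valid ((G ∖ Y) ∖ (p ∷ [])) f → N₂ G p q o → q ∈ Y →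
    Free ((G ∖ Y) ∖ (p ∷ [])) f o k → Painting (G ∖ Y) (⟨ p , k , o ⟩ ∷ []) f
  attach {Y} V N q∈ free = extend-paint _ V ([] ∷ [])
    ((λ { (a , _ , z∉) → [ (λ { refl → clash q∈ z∉ }) , inj₂ ]′ (N₂.cover N a) }) ∷ []) ((λ _ → free) ∷ [])

  -- With both outer vertices deleted as well, `q`, `s` and `w′` have colour 0. Then `u′` and `v′`
  -- can share one colour `α`, leaving two nonzero colours for `v` and `w`, and 0 for `u`. Only `w`
  -- has a further constraint, the colour of `e`.
  noTwoLong : ∀ {u v w u′ v′ w′ q r s t} → Tri G u v w u′ v′ w′ →
    N₂ G u′ u q → N₂ G q u′ r → Three G r → N₂ G v′ v s → N₂ G s v′ t → Three G t → ⊥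
  noTwoLong {u} {v} {w} {u′} {v′} {w′} {q} {r} {s} {t} T Nu′ Nq 3r Nv′ Ns 3t
    with outer₂ (cycle (cycle T))
  ... | e , Nw′ = ih X (1st refl) (N₃.va nu) λ (f , N) → go f N
    where
    open Tri T
    A Y X : List (Fin n)
    A = u ∷ v ∷ w ∷ []
    Y = A ++ v′ ∷ []
    X = Y ++ u′ ∷ []
    w′-low = outer-low (cycle (cycle T))
    indep = outer-independent T
    touched : All (λ x → ∃ (Adj x)) X
    touched = (_ , N₃.va nu) ∷ (_ , N₃.va nv) ∷ (_ , N₃.va nw) ∷ (_ , N₂.va Nv′) ∷ (_ , N₂.va Nu′) ∷ []
    s≢u′ : s ≢ u′
    s≢u′ refl = proj₁ indep (symm (N₂.vb Nv′))
    near-u : ∀ {y} → Fresh y X → ¬ Adj y u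
    near-u (_ ∷ y≢v ∷ y≢w ∷ _ ∷ y≢u′ ∷ []) a = y≢u′ (same₃ {G = G} class nu (symm a) y≢v y≢w)
    near-v : ∀ {y} → Fresh y X → ¬ Adj y v
    near-v (y≢u ∷ _ ∷ y≢w ∷ y≢v′ ∷ _) a = y≢v′ (same₃ {G = G} class nv (symm a) y≢w y≢u)
    near-w : ∀ {y} → Fresh y X → Adj y w → y ≡ w′
    near-w (y≢u ∷ y≢v ∷ _) a = same₃ {G = G} class nw (symm a) y≢u y≢v
    second-q : ∀ {y} → Adj q y → y ≢ u′ → Fresh y X → ∀ {z} → Adj y z → z ∈ X → ⊥
    second-q a y≢u′ y∉ b z∈ with N₂.cover Nq a
    ... | inj₁ e = y≢u′ e
    second-q a _ y∉ b (1st refl) | inj₂ refl = near-u y∉ b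
    second-q a _ y∉ b (2nd refl) | inj₂ refl = near-v y∉ b
    second-q a _ y∉ b (3rd refl) | inj₂ refl = low≢three w′-low 3r (sym (near-w y∉ b))
    second-q a _ y∉ b (4th refl) | inj₂ refl =
      [ (λ { refl → clash (2nd refl) y∉ }) , (λ { refl → ¬three Ns 3r }) ]′ (N₂.cover Nv′ (symm b))
    second-q a _ y∉ b (5th refl) | inj₂ refl =
      [ (λ { refl → clash (1st refl) y∉ }) , (λ { refl → irrefl a }) ]′ (N₂.cover Nu′ (symm b))
    second-s : ∀ {y} → Adj s y → y ≢ v′ → Fresh y X → ∀ {z} → Adj y z → z ∈ X → ⊥
    second-s a y≢v′ y∉ b z∈ with N₂.cover Ns a
    ... | inj₁ e = y≢v′ e
    second-s a _ y∉ b (1st refl) | inj₂ refl = near-u y∉ b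
    second-s a _ y∉ b (2nd refl) | inj₂ refl = near-v y∉ b
    second-s a _ y∉ b (3rd refl) | inj₂ refl = low≢three w′-low 3t (sym (near-w y∉ b))
    second-s a _ y∉ b (4th refl) | inj₂ refl =
      [ (λ { refl → clash (2nd refl) y∉ }) , (λ { refl → irrefl a }) ]′ (N₂.cover Nv′ (symm b))
    second-s a _ y∉ b (5th refl) | inj₂ refl =
      [ (λ { refl → clash (1st refl) y∉ }) , (λ { refl → ¬three Nq 3t }) ]′ (N₂.cover Nu′ (symm b))
    second-w : ∀ {y} → Adj w′ y → y ≢ w → Fresh y X → ∀ {z} → Adj y z → z ∈ X → ⊥
    second-w a _ y∉ b (1st refl) = near-u y∉ b
    second-w a _ y∉ b (2nd refl) = near-v y∉ b
    second-w a _ y∉ b (3rd refl) with near-w y∉ b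
    ... | refl = irrefl a
    second-w a _ y∉ b (4th refl) with N₂.cover Nv′ (symm b)
    ... | inj₁ refl = clash (2nd refl) y∉
    ... | inj₂ refl = [ ≢-sym v′≢w′ , low≢three w′-low 3t ]′ (N₂.cover Ns (symm a))
    second-w a _ y∉ b (5th refl) with N₂.cover Nu′ (symm b)
    ... | inj₁ refl = clash (1st refl) y∉
    ... | inj₂ refl = [ w′≢u′ , low≢three w′-low 3r ]′ (N₂.cover Nq (symm a))
    go : ∀ f → Nice (G ∖ X) f → ⊥
    go f N with outer₀ N (5th refl) (N₂.va Nq) (¬three Nq) second-q
              | outer₀ N (4th refl) (N₂.va Ns) (¬three Ns) second-s
              | outer₀ N (3rd refl) (N₂.va Nw′) w′-low second-w
              | avoid₂ (f r) (f t)
    ... | q≡0 | s≡0 | w′≡0 | α , α≢0 , α≢r , α≢t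
      with avoid₂ α (f e)
    ... | γ , γ≢0 , γ≢α , γ≢e with avoid₂ α γ
    ... | β , β≢0 , β≢α , β≢γ
      with attach {Y} {f = f} (Valid-⊑ (∖∖⊑ {G = G} {X = Y}) (Nice.valid N)) Nu′ (1st refl)
        (Free-⊑ {G = G ∖ X} {H = (G ∖ Y) ∖ (u′ ∷ [])} {f} {q} (∖∖⊑ {G = G} {X = Y})
          (free₂ {f = f} Nq (5th refl) q≡0 α≢0 α≢r))
    ... | f₁ , V₁ , (u′≡α ∷ []) , agree₁
      with attach {A} {f = f₁} (Valid-⊑ (∖∖⊑ {G = G} {X = A}) V₁) Nv′ (2nd refl)
        (Free-⊑ {G = G ∖ Y} {H = (G ∖ A) ∖ (v′ ∷ [])} {f₁} {s} (∖∖⊑ {G = G} {X = A})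
          (free₂ {f = f₁} Ns (4th refl) (trans (agree₁ (s≢u′ ∷ [])) s≡0) α≢0
            (λ p → α≢t (trans p (agree₁ (≢-sym (low≢three (outer-low T) 3t) ∷ []))))))
    ... | f₂ , V₂ , (v′≡α ∷ []) , agree₂
      with tri-paint T G {f = f₂} {0F} {β} {γ} id V₂ (≢-sym β≢0) (≢-sym γ≢0) β≢γ
        (λ _ → Free-0 {G = G ∖ A} {f₂} refl (λ p → α≢0 (trans (sym u′≡α₂) p)) , α-ok β≢α , α-ok γ≢α)
        (λ _ → ((λ p → β≢α (trans p v′≡α)) , at-v′) , compatible-0 refl ,
          ≢⇒Compatible λ p → γ≢α (trans (sym p) v′≡α))
        (λ _ → free₂ {f = f₂} Nw′ (3rd refl) w′≡0₂ γ≢0 (λ p → γ≢e (trans p e≡₂)) , 0-compatible w′≡0₂ , 0-compatible w′≡0₂)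
      where
      off : ∀ {z} → z ≢ v′ → z ≢ u′ → f₂ z ≡ f z
      off p q = trans (agree₂ (p ∷ [])) (agree₁ (q ∷ []))
      u′≡α₂ : f₂ u′ ≡ α
      u′≡α₂ = trans (agree₂ (u′≢v′ ∷ [])) u′≡α
      w′≡0₂ : f₂ w′ ≡ 0F
      w′≡0₂ = trans (off (≢-sym v′≢w′) w′≢u′) w′≡0
      e≡₂ : f₂ e ≡ f e
      e≡₂ = off (λ { refl → proj₁ (proj₂ indep) (symm (N₂.vb Nw′)) }) (λ { refl → proj₂ (proj₂ indep) (N₂.vb Nw′) })
      α-ok : ∀ {k} → k ≢ α → Compatible (f₂ u′) k
      α-ok k≢α = ≢⇒Compatible λ p → k≢α (trans (sym p) u′≡α₂)
      at-v′ : ∀ {z} → Graph.Adj (G ∖ A) v′ z → Compatible β (f₂ z)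
      at-v′ (a , _ , z∉) with N₂.cover Nv′ a
      ... | inj₁ refl = clash (2nd refl) z∉
      ... | inj₂ refl = compatible-0 (trans (off (≢-sym (≢-adj {G = G} (N₂.vb Nv′))) s≢u′) s≡0)
    ... | g , V , _ , agree = finish₃ X N V touched λ z∉ →
      trans (agree (++⁻ˡ A (++⁻ˡ Y z∉))) (trans (agree₂ (++⁻ʳ A (++⁻ˡ Y z∉))) (agree₁ (++⁻ʳ Y z∉)))

  -- Two triangles u v w and t d e whose vertices u and t share the outer neighbour o.
  module Link {u v w t d e o v′ w′ d′ e′ : Fin n} (T : Tri G u v w o v′ w′) (R : Tri G t d e o d′ e′)
    (No : N₂ G o u t) where

    private
      A B : List (Fin n)
      A = u ∷ v ∷ w ∷ []
      B = t ∷ d ∷ e ∷ []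

      module T = Tri T
      module R = Tri R

    low-v′ : ¬ Three G v′
    low-v′ = outer-low (cycle T)
    low-w′ : ¬ Three G w′
    low-w′ = outer-low (cycle (cycle T))
    low-d′ : ¬ Three G d′
    low-d′ = outer-low (cycle R)
    low-e′ : ¬ Three G e′
    low-e′ = outer-low (cycle (cycle R))

    off-B : ∀ {y} → ¬ Three G y → Fresh y B
    off-B l = low≢three l (three-u R) ∷ low≢three l (three-v R) ∷ low≢three l (three-w R) ∷ []

    touched-A : All (λ x → ∃ (Adj x)) A
    touched-A = (_ , N₃.va T.nu) ∷ (_ , N₃.va T.nv) ∷ (_ , N₃.va T.nw) ∷ []
    touched-B : All (λ x → ∃ (Adj x)) B
    touched-B = (_ , N₃.va R.nu) ∷ (_ , N₃.va R.nv) ∷ (_ , N₃.va R.nw) ∷ []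

    outers-A : ∀ {y z} → Fresh y A → z ∈ A → Adj y z → y ≡ o ⊎ y ≡ v′ ⊎ y ≡ w′
    outers-A y∉ (1st refl) a = inj₁ (outer-u T (symm a) y∉)
    outers-A y∉ (2nd refl) a = inj₂ (inj₁ (outer-v T (symm a) y∉))
    outers-A y∉ (3rd refl) a = inj₂ (inj₂ (outer-w T (symm a) y∉))

    outers-B : ∀ {y z} → Fresh y B → z ∈ B → Adj y z → y ≡ o ⊎ y ≡ d′ ⊎ y ≡ e′
    outers-B y∉ (1st refl) a = inj₁ (outer-u R (symm a) y∉)
    outers-B y∉ (2nd refl) a = inj₂ (inj₁ (outer-v R (symm a) y∉))
    outers-B y∉ (3rd refl) a = inj₂ (inj₂ (outer-w R (symm a) y∉))

    -- Deleting the two triangles alone would leave the isolated edge `v′ d′`. Deleting `v′` too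
    -- isolates `d′`, which then has colour 0 like `o`, `w′` and `e′`.
    noCross : ∀ {p q} → N₂ G w′ w p → Three G p → N₂ G e′ e q → Three G q → Adj v′ d′ → ⊥
    noCross {p} {q} Nw′ 3p Ne′ 3q v′d′ = ih X (1st refl) (N₃.va T.nu) λ (f , N) → go f N
      where
      Y X : List (Fin n)
      Y = A ++ v′ ∷ []
      X = Y ++ B
      Nv′ : N₂ G v′ v d′
      Nv′ = low (symm (N₃.vc T.nv)) v′d′ (≢-sym (low≢three low-d′ (three-v T))) low-v′
      Nd′ : N₂ G d′ d v′
      Nd′ = low (symm (N₃.vc R.nv)) (symm v′d′) (≢-sym (low≢three low-v′ (three-v R))) low-d′
      split : ∀ {z} → z ∈ X → z ∈ A ⊎ z ≡ v′ ⊎ z ∈ B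
      split (1st r) = inj₁ (1st r)
      split (2nd r) = inj₁ (2nd r)
      split (3rd r) = inj₁ (3rd r)
      split (4th r) = inj₂ (inj₁ r)
      split (5th r) = inj₂ (inj₂ (1st r))
      split (6th r) = inj₂ (inj₂ (2nd r))
      split (7th r) = inj₂ (inj₂ (3rd r))
      three-second : ∀ {y z} → Three G y → Fresh y X → Adj y z → z ∈ X → ⊥
      three-second 3y y∉ a z∈ with split z∈
      ... | inj₁ z∈A = [ (λ { refl → outer-low T 3y }) , [ (λ { refl → low-v′ 3y }) , (λ { refl → low-w′ 3y }) ]′ ]′
              (outers-A (++⁻ˡ A (++⁻ˡ Y y∉)) z∈A a)
      ... | inj₂ (inj₁ refl) = [ (λ { refl → clash (2nd refl) y∉ }) , (λ { refl → low-d′ 3y }) ]′ (N₂.cover Nv′ (symm a))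
      ... | inj₂ (inj₂ z∈B) = [ (λ { refl → outer-low T 3y }) , [ (λ { refl → low-d′ 3y }) , (λ { refl → low-e′ 3y }) ]′ ]′
              (outers-B (++⁻ʳ Y y∉) z∈B a)
      second-w : ∀ {y} → Adj w′ y → y ≢ w → Fresh y X → ∀ {z} → Adj y z → z ∈ X → ⊥
      second-w a y≢w y∉ with N₂.cover Nw′ a
      ... | inj₁ r = ⊥-elim (y≢w r)
      ... | inj₂ refl = three-second 3p y∉
      second-e : ∀ {y} → Adj e′ y → y ≢ e → Fresh y X → ∀ {z} → Adj y z → z ∈ X → ⊥
      second-e a y≢e y∉ with N₂.cover Ne′ a
      ... | inj₁ r = ⊥-elim (y≢e r)
      ... | inj₂ refl = three-second 3q y∉
      iso-o : ∀ {z} → ¬ Graph.Adj (G ∖ X) o z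
      iso-o (a , _ , z∉) = [ (λ { refl → clash (1st refl) z∉ }) , (λ { refl → clash (5th refl) z∉ }) ]′ (N₂.cover No a)
      iso-d′ : ∀ {z} → ¬ Graph.Adj (G ∖ X) d′ z
      iso-d′ (a , _ , z∉) = [ (λ { refl → clash (6th refl) z∉ }) , (λ { refl → clash (4th refl) z∉ }) ]′ (N₂.cover Nd′ a)
      go : ∀ f → Nice (G ∖ X) f → ⊥
      go f N with outer₀ N (3rd refl) (N₂.va Nw′) low-w′ second-w | outer₀ N (7th refl) (N₂.va Ne′) low-e′ second-e
                | quiet N iso-o | quiet N iso-d′ | avoid₂ (f q) 0F
      ... | w′≡0 | e′≡0 | o≡0 | d′≡0 | κ , _ , κ≢q , _ with rainbow! κ (f q) (f q) (λ r → κ≢q (proj₁ r))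
      ... | rainbow k l m k≢0 l≢0 m≢0 k≢l k≢m l≢m _ _ m≢q
        with tri-paint R (G ∖ Y) {f = f} proj₁ (Valid-⊑ (∖∖⊑ {G = G} {X = Y}) (Nice.valid N)) k≢l k≢m l≢m
          (λ _ → Free-isolated {G = (G ∖ Y) ∖ B} (λ a → iso-o (∖∖⊑ {G = G} {X = Y} a)) o≡0 k≢0 , 0-compatible o≡0 , 0-compatible o≡0)
          (λ _ → Free-isolated {G = (G ∖ Y) ∖ B} (λ a → iso-d′ (∖∖⊑ {G = G} {X = Y} a)) d′≡0 l≢0 , 0-compatible d′≡0 , 0-compatible d′≡0)
          (λ _ → Free-⊑ {G = G ∖ X} {H = (G ∖ Y) ∖ B} {f} {e′} (∖∖⊑ {G = G} {X = Y}) (free₂ {f = f} Ne′ (7th refl) e′≡0 m≢0 m≢q) ,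
            0-compatible e′≡0 , 0-compatible e′≡0)
      -- The nonzero colours go to `u`, `v′` and `w`, with 0 on `v`. Forbidden are `k` at `u` (from
      -- `t` beyond `o`), `l` at `v′` (from `d` beyond `d′`) and the colour of `p` at `w`, read only
      -- now because `p` may lie on the triangle just painted. As `k ≢ l`, this always succeeds.
      ... | f₁ , V₁ , (t≡k ∷ d≡l ∷ _ ∷ []) , agree₁ with rainbow! k l (f₁ p) (λ r → k≢l (proj₁ r))
      ... | rainbow α β γ α≢0 β≢0 γ≢0 α≢β α≢γ β≢γ α≢k β≢l γ≢p
        with attach {A} {f = f₁} (Valid-⊑ (∖∖⊑ {G = G} {X = A}) V₁) Nv′ (2nd refl)
          (Free-⊑ {G = G ∖ Y} {H = (G ∖ A) ∖ (v′ ∷ [])} {f₁} {d′} (∖∖⊑ {G = G} {X = A})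
            (free₂ {f = f₁} (swap₂ Nd′) (4th refl) (trans (agree₁ (off-B low-d′)) d′≡0) β≢0 (λ r → β≢l (trans r d≡l))))
      ... | f₂ , V₂ , (v′≡β ∷ []) , agree₂
        with tri-paint T G {f = f₂} {α} {0F} {γ} id V₂ α≢0 α≢γ (≢-sym γ≢0)
          (λ _ → free₂ {f = f₂} No (1st refl) o≡0₂ α≢0
             (λ r → α≢k (trans r (trans (agree₂ (≢-sym (low≢three low-v′ (three-u R)) ∷ [])) t≡k))) , 0-compatible o≡0₂ , 0-compatible o≡0₂)
          (λ _ → Free-0 {G = G ∖ A} {f₂} refl (λ r → β≢0 (trans (sym v′≡β) r)) ,
            ≢⇒Compatible (λ r → α≢β (trans (sym r) v′≡β)) , ≢⇒Compatible (λ r → β≢γ (trans (sym v′≡β) r)))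
          (λ _ → free₂ {f = f₂} Nw′ (3rd refl) w′≡0₂ γ≢0
             (λ r → γ≢p (trans r (agree₂ (≢-sym (low≢three low-v′ 3p) ∷ [])))) , 0-compatible w′≡0₂ , 0-compatible w′≡0₂)
        where
        o≡0₂ : f₂ o ≡ 0F
        o≡0₂ = trans (agree₂ (T.u′≢v′ ∷ [])) (trans (agree₁ (off-B (outer-low T))) o≡0)
        w′≡0₂ : f₂ w′ ≡ 0F
        w′≡0₂ = trans (agree₂ (≢-sym T.v′≢w′ ∷ [])) (trans (agree₁ (off-B low-w′)) w′≡0)
      ... | g , V , _ , agree = finish₃ X N V (++⁺ touched-A ((_ , N₂.va Nv′) ∷ touched-B)) λ z∉ →
        trans (agree (++⁻ˡ A (++⁻ˡ Y z∉))) (trans (agree₂ (++⁻ʳ A (++⁻ˡ Y z∉))) (agree₁ (++⁻ʳ Y z∉)))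

    module _ {v″ w″ d″ e″ : Fin n} (Nv′ : N₂ G v′ v v″) (Nw′ : N₂ G w′ w w″)
      (Nd′ : N₂ G d′ d d″) (Ne′ : N₂ G e′ e e″)
      (v′≁d′ : ¬ Adj v′ d′) (v′≁e′ : ¬ Adj v′ e′) (w′≁d′ : ¬ Adj w′ d′) (w′≁e′ : ¬ Adj w′ e′) where

      private
        X : List (Fin n)
        X = A ++ B

        sub : ((G ∖ A) ∖ B) ⊑ (G ∖ X)
        sub = ∖∖⊑ {G = G} {X = A}

        indep = outer-independent T
        indepᴿ = outer-independent R

      iso-o : ∀ {z} → ¬ Graph.Adj (G ∖ X) o z
      iso-o (a , _ , z∉) = [ (λ { refl → clash (1st refl) z∉ }) , (λ { refl → clash (4th refl) z∉ }) ]′ (N₂.cover No a)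

      second : ∀ {c} → ¬ Adj c o → ¬ (Adj c v′) → ¬ (Adj c w′) → ¬ (Adj c d′) → ¬ (Adj c e′) →
        ∀ {y} → Adj c y → Fresh y X → ∀ {z} → Adj y z → z ∈ X → ⊥
      second ¬o ¬v ¬w ¬d ¬e a y∉ b z∈ with ∈-++⁻ A z∈
      ... | inj₁ z∈A = [ (λ { refl → ¬o a }) , [ (λ { refl → ¬v a }) , (λ { refl → ¬w a }) ]′ ]′ (outers-A (++⁻ˡ A y∉) z∈A b)
      ... | inj₂ z∈B = [ (λ { refl → ¬o a }) , [ (λ { refl → ¬d a }) , (λ { refl → ¬e a }) ]′ ]′ (outers-B (++⁻ʳ A y∉) z∈B b)

      zeros : ∀ {f} → Nice (G ∖ X) f → f v′ ≡ 0F × f w′ ≡ 0F × f d′ ≡ 0F × f e′ ≡ 0F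
      zeros N =
        outer₀ N (2nd refl) (N₂.va Nv′) low-v′ (λ a _ → second (λ b → proj₁ indep (symm b)) irrefl (proj₁ (proj₂ indep)) v′≁d′ v′≁e′ a) ,
        outer₀ N (3rd refl) (N₂.va Nw′) low-w′ (λ a _ → second (proj₂ (proj₂ indep)) (λ b → proj₁ (proj₂ indep) (symm b)) irrefl w′≁d′ w′≁e′ a) ,
        outer₀ N (5th refl) (N₂.va Nd′) low-d′ (λ a _ → second (λ b → proj₁ indepᴿ (symm b)) (λ b → v′≁d′ (symm b)) (λ b → w′≁d′ (symm b))
          irrefl (proj₁ (proj₂ indepᴿ)) a) ,
        outer₀ N (6th refl) (N₂.va Ne′) low-e′ (λ a _ → second (proj₂ (proj₂ indepᴿ)) (λ b → v′≁e′ (symm b)) (λ b → w′≁e′ (symm b))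
          (λ b → proj₁ (proj₂ indepᴿ) (symm b)) irrefl a)

      module _ {f : Fin n → Colour} (N : Nice (G ∖ X) f) where
        v′≡0 = proj₁ (zeros N)
        w′≡0 = proj₁ (proj₂ (zeros N))
        d′≡0 = proj₁ (proj₂ (proj₂ (zeros N)))
        e′≡0 = proj₂ (proj₂ (proj₂ (zeros N)))
        o≡0 = quiet N iso-o

        -- Once `t d e` is painted, `u`, `v`, `w` must avoid the colours of `t`, `v″`, `w″`. These
        -- are taken from `f₁`, since `v″` and `w″` may lie on the triangle `t d e`.
        glue : ∀ {k l m} → k ≢ 0F → l ≢ 0F → m ≢ 0F → k ≢ l → k ≢ m → l ≢ m → l ≢ f d″ → m ≢ f e″ →
          (∀ {f₁ : Fin n → Colour} → f₁ t ≡ k → f₁ d ≡ l → f₁ e ≡ m → (∀ {z} → Fresh z B → f₁ z ≡ f z) →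
            ¬ (f₁ t ≡ f₁ v″ × f₁ v″ ≡ f₁ w″)) → ⊥
        glue k≢0 l≢0 m≢0 k≢l k≢m l≢m l≢d″ m≢e″ uneven
          with tri-paint R (G ∖ A) {f = f} proj₁ (Valid-⊑ sub (Nice.valid N)) k≢l k≢m l≢m
            (λ _ → Free-isolated {G = (G ∖ A) ∖ B} (λ a → iso-o (sub a)) o≡0 k≢0 , 0-compatible o≡0 , 0-compatible o≡0)
            (λ _ → Free-⊑ {G = G ∖ X} {H = (G ∖ A) ∖ B} {f} {d′} sub (free₂ {f = f} Nd′ (5th refl) d′≡0 l≢0 l≢d″) ,
              0-compatible d′≡0 , 0-compatible d′≡0)
            (λ _ → Free-⊑ {G = G ∖ X} {H = (G ∖ A) ∖ B} {f} {e′} sub (free₂ {f = f} Ne′ (6th refl) e′≡0 m≢0 m≢e″) ,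
              0-compatible e′≡0 , 0-compatible e′≡0)
        ... | f₁ , V₁ , (t≡ ∷ d≡ ∷ e≡ ∷ []) , agree₁ with rainbow! (f₁ t) (f₁ v″) (f₁ w″) (uneven t≡ d≡ e≡ agree₁)
        ... | rainbow α β γ α≢0 β≢0 γ≢0 α≢β α≢γ β≢γ α≢t β≢v″ γ≢w″
          with tri-paint T G {f = f₁} id V₁ α≢β α≢γ β≢γ
            (λ _ → free₂ {f = f₁} No (1st refl) o≡0₁ α≢0 α≢t , 0-compatible o≡0₁ , 0-compatible o≡0₁)
            (λ _ → free₂ {f = f₁} Nv′ (2nd refl) v′≡0₁ β≢0 β≢v″ , 0-compatible v′≡0₁ , 0-compatible v′≡0₁)
            (λ _ → free₂ {f = f₁} Nw′ (3rd refl) w′≡0₁ γ≢0 γ≢w″ , 0-compatible w′≡0₁ , 0-compatible w′≡0₁)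
          where
          o≡0₁ = trans (agree₁ (off-B (outer-low T))) o≡0
          v′≡0₁ = trans (agree₁ (off-B low-v′)) v′≡0
          w′≡0₁ = trans (agree₁ (off-B low-w′)) w′≡0
        ... | g , V , _ , agree = finish₃ X N V (++⁺ touched-A touched-B) λ z∉ →
          trans (agree (++⁻ˡ A z∉)) (agree₁ (++⁻ʳ A z∉))

        -- If all four second neighbours carry the same colour, this colour goes to o while u and t get 0.
        bowtie : Fresh v″ B → Fresh w″ B → f v″ ≢ 0F → f v″ ≡ f w″ → f v″ ≡ f d″ → f v″ ≡ f e″ → ⊥
        bowtie v″∉ w″∉ a≢0 v≡w v≡d v≡e with avoid₂ (f v″) (f v″)
        ... | b , b≢0 , b≢a , _ with avoid₂ (f v″) b
        ... | c , c≢0 , c≢a , c≢b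
          -- `o` is isolated at this stage, so it can be repainted as if it were deleted too.
          with extend-paint {G = (G ∖ A) ∖ B} {f} (⟨ o , f v″ , o ⟩ ∷ []) (Valid-⊑ (λ a → sub (proj₁ a)) (Nice.valid N))
            ([] ∷ []) ((λ a → ⊥-elim (iso-o (sub a))) ∷ []) ((λ a → ⊥-elim (iso-o (sub a))) ∷ [])
        ... | f₀ , V₀ , (o≡a ∷ []) , agree₀
          with tri-paint R (G ∖ A) {f = f₀} {0F} {b} {c} proj₁ V₀ (≢-sym b≢0) (≢-sym c≢0) (≢-sym c≢b)
            (λ _ → Free-0 {G = (G ∖ A) ∖ B} {f₀} refl (λ r → a≢0 (trans (sym o≡a) r)) ,
              ≢⇒Compatible (λ r → b≢a (trans (sym r) o≡a)) , ≢⇒Compatible (λ r → c≢a (trans (sym r) o≡a)))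
            (λ _ → Free-⊑ {G = G ∖ X} {H = (G ∖ A) ∖ B} {f₀} {d′} sub (free₂ {f = f₀} Nd′ (5th refl) d′≡0₀ b≢0
                (λ r → b≢a (trans r (trans (agree₀ (d″≢o ∷ [])) (sym v≡d))))) ,
              0-compatible d′≡0₀ , 0-compatible d′≡0₀)
            (λ _ → Free-⊑ {G = G ∖ X} {H = (G ∖ A) ∖ B} {f₀} {e′} sub (free₂ {f = f₀} Ne′ (6th refl) e′≡0₀ c≢0
                (λ r → c≢a (trans r (trans (agree₀ (e″≢o ∷ [])) (sym v≡e))))) ,
              0-compatible e′≡0₀ , 0-compatible e′≡0₀)
          where
          d′≡0₀ = trans (agree₀ (≢-sym R.u′≢v′ ∷ [])) d′≡0
          e′≡0₀ = trans (agree₀ (R.w′≢u′ ∷ [])) e′≡0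
          d″≢o : d″ ≢ o
          d″≢o refl = proj₁ indepᴿ (symm (N₂.vb Nd′))
          e″≢o : e″ ≢ o
          e″≢o refl = proj₂ (proj₂ indepᴿ) (N₂.vb Ne′)
        ... | f₁ , V₁ , _ , agree₁
          with tri-paint T G {f = f₁} {0F} {b} {c} id V₁ (≢-sym b≢0) (≢-sym c≢0) (≢-sym c≢b)
            (λ _ → Free-0 {G = G ∖ A} {f₁} refl (λ r → a≢0 (trans (sym o≡a₁) r)) ,
              ≢⇒Compatible (λ r → b≢a (trans (sym r) o≡a₁)) , ≢⇒Compatible (λ r → c≢a (trans (sym r) o≡a₁)))
            (λ _ → free₂ {f = f₁} Nv′ (2nd refl) v′≡0₁ b≢0 (λ r → b≢a (trans r (off v″∉ v″≢o))) ,
              0-compatible v′≡0₁ , 0-compatible v′≡0₁)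
            (λ _ → free₂ {f = f₁} Nw′ (3rd refl) w′≡0₁ c≢0 (λ r → c≢a (trans r (trans (off w″∉ w″≢o) (sym v≡w)))) ,
              0-compatible w′≡0₁ , 0-compatible w′≡0₁)
          where
          off : ∀ {z} → Fresh z B → z ≢ o → f₁ z ≡ f z
          off z∉ z≢o = trans (agree₁ z∉) (agree₀ (z≢o ∷ []))
          o≡a₁ = trans (agree₁ (off-B (outer-low T))) o≡a
          v′≡0₁ = trans (off (off-B low-v′) (≢-sym T.u′≢v′)) v′≡0
          w′≡0₁ = trans (off (off-B low-w′) T.w′≢u′) w′≡0
          v″≢o : v″ ≢ o
          v″≢o refl = proj₁ indep (symm (N₂.vb Nv′))
          w″≢o : w″ ≢ o
          w″≢o refl = proj₂ (proj₂ indep) (N₂.vb Nw′)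
        ... | g , V , _ , agree = finish₃ (X ++ o ∷ []) N V (++⁺ touched-A (++⁺ touched-B ((_ , N₂.va No) ∷ []))) λ z∉ →
          trans (agree (++⁻ˡ A z∉)) (trans (agree₁ (++⁻ˡ B (++⁻ʳ A z∉))) (agree₀ (++⁻ʳ B (++⁻ʳ A z∉))))

        glue-any : (∀ {k l m} {f₁ : Fin n → Colour} → k ≢ 0F → k ≢ l → k ≢ m → f₁ t ≡ k → f₁ d ≡ l → f₁ e ≡ m →
          (∀ {z} → Fresh z B → f₁ z ≡ f z) → ¬ (f₁ t ≡ f₁ v″ × f₁ v″ ≡ f₁ w″)) → ⊥
        glue-any uneven with avoid₂ (f d″) (f d″)
        ... | κ , _ , κ≢d , _ with rainbow! κ (f d″) (f e″) (λ r → κ≢d (proj₁ r))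
        ... | rainbow k l m k≢0 l≢0 m≢0 k≢l k≢m l≢m _ l≢d m≢e =
          glue k≢0 l≢0 m≢0 k≢l k≢m l≢m l≢d m≢e (uneven k≢0 k≢l k≢m)

        -- Trouble arises only if `v″` and `w″` share a nonzero colour. Then `t` should avoid it,
        -- which is possible unless `d″` and `e″` have that colour as well: the case of `bowtie`.
        distinct-case : Fresh v″ B → Fresh w″ B → ⊥
        distinct-case v″∉ w″∉ with f v″ ≟ f w″ | f v″ ≟ 0F
        ... | no v≢w | _ = glue-any λ _ _ _ _ _ _ agree (_ , r) → v≢w (trans (sym (agree v″∉)) (trans r (agree w″∉)))
        ... | _ | yes v≡0 = glue-any λ k≢0 _ _ t≡k _ _ agree (r , _) → k≢0 (trans (sym t≡k) (trans r (trans (agree v″∉) v≡0)))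
        ... | yes v≡w | no v≢0 with f v″ ≟ f d″ | f d″ ≟ f e″
        ...   | yes v≡d | yes d≡e = bowtie v″∉ w″∉ v≢0 v≡w v≡d (trans v≡d d≡e)
        ...   | no v≢d | _ with rainbow! (f v″) (f d″) (f e″) (λ r → v≢d (proj₁ r))
        ...     | rainbow k l m k≢0 l≢0 m≢0 k≢l k≢m l≢m k≢v l≢d m≢e =
                    glue k≢0 l≢0 m≢0 k≢l k≢m l≢m l≢d m≢e λ t≡k _ _ agree (r , _) → k≢v (trans (sym t≡k) (trans r (agree v″∉)))
        distinct-case v″∉ w″∉ | yes v≡w | no v≢0 | yes v≡d | no d≢e with rainbow! (f v″) (f d″) (f e″) (λ r → d≢e (proj₂ r))
        ...     | rainbow k l m k≢0 l≢0 m≢0 k≢l k≢m l≢m k≢v l≢d m≢e =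
                    glue k≢0 l≢0 m≢0 k≢l k≢m l≢m l≢d m≢e λ t≡k _ _ agree (r , _) → k≢v (trans (sym t≡k) (trans r (agree v″∉)))

        in-B : ∀ {z} → z ∈ B → Adj z v′ ⊎ Adj z w′ → z ≢ t
        in-B z∈ (inj₁ a) refl = [ (λ r → low-v′ (subst (Three G) (sym r) (three-v R))) ,
          [ (λ r → low-v′ (subst (Three G) (sym r) (three-w R))) , (λ r → T.u′≢v′ (sym r)) ]′ ]′ (subcubic R.nu a)
        in-B z∈ (inj₂ a) refl = [ (λ r → low-w′ (subst (Three G) (sym r) (three-v R))) ,
          [ (λ r → low-w′ (subst (Three G) (sym r) (three-w R))) , T.w′≢u′ ]′ ]′ (subcubic R.nu a)

        linked : ⊥
        linked with fresh? v″ B | fresh? w″ B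
        ... | inj₂ v″∉ | inj₂ w″∉ = distinct-case v″∉ w″∉
        ... | inj₁ (1st r) | _ = in-B (1st r) (inj₁ (symm (N₂.vb Nv′))) r
        -- A second neighbour on the other triangle is not `t`, so its colour differs from that of
        -- `t` and the constraints cannot all agree.
        ... | inj₁ (2nd refl) | _ = glue-any λ _ k≢l _ t≡ d≡ _ _ (r , _) → k≢l (trans (sym t≡) (trans r d≡))
        ... | inj₁ (3rd refl) | _ = glue-any λ _ _ k≢m t≡ _ e≡ _ (r , _) → k≢m (trans (sym t≡) (trans r e≡))
        ... | _ | inj₁ (1st r) = in-B (1st r) (inj₂ (symm (N₂.vb Nw′))) r
        ... | _ | inj₁ (2nd refl) = glue-any λ _ k≢l _ t≡ d≡ _ _ (r , s) → k≢l (trans (sym t≡) (trans r (trans s d≡)))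
        ... | _ | inj₁ (3rd refl) = glue-any λ _ _ k≢m t≡ _ e≡ _ (r , s) → k≢m (trans (sym t≡) (trans r (trans s e≡)))

      noLink : ⊥
      noLink = ih X (1st refl) (N₃.va T.nu) λ (f , N) → linked N

-- A minimal counterexample has no edges

module Conclusion {n : ℕ} {G : Graph n} (M : Minimal G) where
  open Graph G renaming (sym to symm)
  open Minimal M
  open Class class
  open Sparse M
  open Triangles M
  open Hats M
  open Threads M

  -- The edge would make `v′ d′` the interior of a long thread. A second long one at `w` or `e`
  -- contradicts `noTwoLong`; if both are short, `noCross` applies.
  cross : ∀ {u v w t d e o v′ w′ d′ e′} → Tri G u v w o v′ w′ → Tri G t d e o d′ e′ → N₂ G o u t → ¬ Adj v′ d′
  cross T R No a with thread (cycle (cycle T)) | thread (cycle (cycle R))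
  ... | short Nw 3p | short Ne 3q = Link.noCross T R No Nw 3p Ne 3q a
  ... | long Nw Np 3r | _ = noTwoLong (cycle T)
        (low (symm (N₃.vc (Tri.nv T))) a (≢-sym (low≢three (outer-low (cycle R)) (three-v T))) (outer-low (cycle T)))
        (low (symm a) (symm (N₃.vc (Tri.nv R))) (low≢three (outer-low (cycle T)) (three-v R)) (outer-low (cycle R)))
        (three-v R) Nw Np 3r
  ... | _ | long Ne Nq 3r = noTwoLong (cycle R)
        (low (symm (N₃.vc (Tri.nv R))) (symm a) (≢-sym (low≢three (outer-low (cycle T)) (three-v R))) (outer-low (cycle R)))
        (low a (symm (N₃.vc (Tri.nv T))) (low≢three (outer-low (cycle R)) (three-v T)) (outer-low (cycle T)))
        (three-v T) Ne Nq 3r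

  noShort : ∀ {u v w u′ v′ w′ t} → Tri G u v w u′ v′ w′ → N₂ G u′ u t → Three G t → ⊥
  noShort {u = u} T No 3t with last₃ {G = G} class 3t (symm (N₂.vb No))
  ... | a , b , N = go (triangle N)
    where
    not-outer : ∀ {x} → Adj _ x → Adj x _ → ⊥
    not-outer p q with N₂.cover No (symm q)
    ... | inj₁ refl = tri-apex T (N₂.vb No) p
    ... | inj₂ refl = irrefl p
    go : Adj a b ⊎ Adj a _ ⊎ Adj b _ → ⊥
    go (inj₂ (inj₁ q)) = not-outer (N₃.va N) q
    go (inj₂ (inj₂ q)) = not-outer (N₃.vb N) q
    go (inj₁ ab) with tri-at N ab
    ... | _ , _ , _ , _ , R = Link.noLink T R No
      (proj₂ (outer₂ (cycle T))) (proj₂ (outer₂ (cycle (cycle T))))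
      (proj₂ (outer₂ (cycle R))) (proj₂ (outer₂ (cycle (cycle R))))
      (cross T R No) (cross T (mirror R) No) (cross (mirror T) R No) (cross (mirror T) (mirror R) No)

  noTri : ∀ {u v w u′ v′ w′} → Tri G u v w u′ v′ w′ → ⊥
  noTri T with thread T | thread (cycle T)
  ... | short N 3t | _ = noShort T N 3t
  ... | _ | short N 3t = noShort (cycle T) N 3t
  ... | long N N′ 3r | long L L′ 3s = noTwoLong T N N′ 3r L L′ 3s

  noThree : ∀ {v} → Three G v → ⊥
  noThree (_ , _ , _ , N) with triangle N
  ... | inj₁ ab = noTri (proj₂ (proj₂ (proj₂ (proj₂ (tri-at N ab)))))
  ... | inj₂ (inj₁ ac) = noTri (proj₂ (proj₂ (proj₂ (proj₂ (tri-at (swap-last N) ac)))))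
  ... | inj₂ (inj₂ bc) = noTri (proj₂ (proj₂ (proj₂ (proj₂ (tri-at (rotate₃ N) bc)))))

  only-two : ∀ {v a} → Adj v a → ∃ λ b → N₂ G v a b
  only-two a with two-or-three a
  ... | inj₁ N = N
  ... | inj₂ t = ⊥-elim (noThree t)

  -- Every vertex with a neighbour now has degree 2, so an edge extends to the path excluded by
  -- `noPath`.
  edgeless : ∀ {v w} → ¬ Adj v w
  edgeless a with only-two a | only-two (symm a)
  ... | b , Nv | _ , Nw with only-two (symm (N₂.vb Nv))
  ...   | _ , Nb = noPath Nv Nb Nw

-- The induction, the search for a colouring, and the translation of the hypotheses

unique-⊆-length : ∀ {n} {xs ys : List (Fin n)} → Unique xs → All (_∈ ys) xs → length xs ≤ length ys
unique-⊆-length [] [] = z≤n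
unique-⊆-length {ys = ys} (x≢ ∷ u) (x∈ ∷ xs∈) = ≤-trans
  (s≤s (unique-⊆-length u (All.zipWith (λ (p , q) → ∈-filter⁺ (λ y → ¬? (_ ≟ y)) q p) (x≢ , xs∈))))
  (filter-notAll (λ y → ¬? (_ ≟ y)) ys (Any.map (λ e ne → ne e) x∈))

module _ {n : ℕ} where

  touched? : (G : Graph n) → ∀ v → Dec (∃ (Graph.Adj G v))
  touched? G v = any? (Graph.adj? G v)

  -- Deletion keeps the vertex set, so the measure counts the vertices that are not isolated.
  size : Graph n → ℕ
  size G = length (filter (touched? G) (allFin n))

  size-∖ : ∀ {G : Graph n} X {x y} → x ∈ X → Graph.Adj G x y → size (G ∖ X) < size G
  size-∖ {G} X {x} x∈ a = unique-⊆-length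
    (All.tabulate (λ m e → untouched (subst (λ v → ∃ (Graph.Adj (G ∖ X) v)) (sym e) (proj₂ (back m)))) ∷
      filter⁺ (touched? (G ∖ X)) (allFin⁺ n))
    (∈-filter⁺ (touched? G) (∈-allFin x) (_ , a) ∷
      All.tabulate λ m → ∈-filter⁺ (touched? G) (∈-allFin _) (let w , b , _ = proj₂ (back m) in w , b))
    where
    back : ∀ {v} → v ∈ filter (touched? (G ∖ X)) (allFin n) → v ∈ allFin n × ∃ (Graph.Adj (G ∖ X) v)
    back = ∈-filter⁻ (touched? (G ∖ X)) {xs = allFin n}
    untouched : ¬ ∃ (Graph.Adj (G ∖ X) x)
    untouched (_ , _ , x∉ , _) = clash x∈ x∉

  good : ∀ (G : Graph n) → Acc _<_ (size G) → Class G → ¬ ¬ Good G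
  good G (acc rec) C bad = bad ((λ _ → 0F) ,
    record { proper = λ a → ⊥-elim (Conclusion.edgeless M a) ; apart = λ _ _ _ _ → refl } , λ _ → inj₁ refl)
    where
    M : Minimal G
    M = record
      { class = C
      ; ih    = λ X x∈ a k → good (G ∖ X) (rec (size-∖ {G} X x∈ a)) (Class-∖ X C) (λ g → k (maximise g))
      ; bad   = bad }

  -- Colourings are searched as vectors, since an enumeration reaches functions only up to pointwise
  -- equality.
  any-vec? : ∀ m {P : Vec Colour m → Set} → (∀ xs → Dec (P xs)) → Dec (∃ P)
  any-vec? ℕ.zero P? = map′ (λ p → [] , p) (λ { ([] , p) → p }) (P? [])
  any-vec? (suc m) P? = map′ (λ (k , xs , p) → k ∷ xs , p) (λ { (k ∷ xs , p) → k , xs , p })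
    (any? λ k → any-vec? m λ xs → P? (k ∷ xs))

  valid? : ∀ (G : Graph n) f → Dec (Valid G f)
  valid? G f = map′
    (λ (p , q) → record { proper = λ {v} {w} → p v w ; apart = λ {v} {w} {w′} → q v w w′ })
    (λ V → (λ _ _ → Valid.proper V) , λ _ _ _ → Valid.apart V)
    ((all? λ v → all? λ w → adj? v w →-dec ¬? (f v ≟ f w)) ×-dec
     (all? λ v → all? λ w → all? λ w′ → adj? v w →-dec (adj? v w′ →-dec
       (¬? (w ≟ w′) →-dec compatible? (f w) (f w′)))))
    where open Graph G

  valid-colouring : ∀ (G : Graph n) → Class G → ∃ (Valid G)
  valid-colouring G C = Vec.lookup (proj₁ found) , proj₂ found
    where
    open Valid
    found : ∃ λ xs → Valid G (Vec.lookup xs)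
    found = decidable-stable (any-vec? n λ xs → valid? G (Vec.lookup xs))
      (λ none → good G (<-wellFounded _) C (λ (f , V , _) → none (Vec.tabulate f , record
        { proper = λ {v} {w} a e → proper V a (trans (sym (lookup∘tabulate f v)) (trans e (lookup∘tabulate f w)))
        ; apart = λ {v} {w} {w′} a b ne e → trans (lookup∘tabulate f w) (apart V a b ne
            (trans (sym (lookup∘tabulate f w)) (trans e (lookup∘tabulate f w′)))) })))

  module _ (G : Graph n) (subcubic₃ : Subcubic G) (saturated₂ : Saturated G 2) (girth : G3 G 3) where
    open Graph G renaming (sym to symm)

    neighbour : ∀ {v w} → Adj v w → w ∈ filter (adj? v) (allFin n)
    neighbour = ∈-filter⁺ (adj? _) (∈-allFin _)

    three-deg : ∀ {v} → Three G v → deg G v ≡ 3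
    three-deg {v} (_ , _ , _ , n₃ va vb vc a≢b a≢c b≢c) = ≤-antisym (subcubic₃ v)
      (unique-⊆-length ((a≢b ∷ a≢c ∷ []) ∷ (b≢c ∷ []) ∷ [] ∷ []) (neighbour va ∷ neighbour vb ∷ neighbour vc ∷ []))

    cover₃ : ∀ {v a b c d} → N₃ G v a b c → Adj v d → d ≡ a ⊎ d ≡ b ⊎ d ≡ c
    cover₃ {v} {a} {b} {c} {d} (n₃ va vb vc a≢b a≢c b≢c) vd with d ≟ a | d ≟ b | d ≟ c
    ... | yes e | _ | _ = inj₁ e
    ... | _ | yes e | _ = inj₂ (inj₁ e)
    ... | _ | _ | yes e = inj₂ (inj₂ e)
    ... | no d≢a | no d≢b | no d≢c = ⊥-elim (<⇒≱ (unique-⊆-length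
      ((d≢a ∷ d≢b ∷ d≢c ∷ []) ∷ (a≢b ∷ a≢c ∷ []) ∷ (b≢c ∷ []) ∷ [] ∷ [])
      (neighbour vd ∷ neighbour va ∷ neighbour vb ∷ neighbour vc ∷ [])) (subcubic₃ v))

    short-cycle : ∀ {v k} → CycleThrough G v k → k ≤ 3 →
      ∃ λ p → ∃ λ q → Adj v p × Adj v q × Adj p q
    short-cycle {k = suc 2} (_ , c , _ , refl , path , close) _ = c 1F , c 2F , path 0F , symm close , path 1F
    short-cycle {k = suc 0} (() , _)
    short-cycle {k = suc 1} (s≤s () , _)
    short-cycle {k = suc (suc (suc (suc _)))} _ (s≤s (s≤s (s≤s ())))

    class : Class G
    class = record
      { subcubic  = cover₃
      ; triangle  = adjacent
      ; saturated = λ {v} N@(n₃ va vb vc a≢b a≢c b≢c) 3a 3b 3c →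
          <⇒≱ (unique-⊆-length ((a≢b ∷ a≢c ∷ []) ∷ (b≢c ∷ []) ∷ [] ∷ [])
            (cubic va 3a ∷ cubic vb 3b ∷ cubic vc 3c ∷ [])) (saturated₂ v (three-deg (_ , _ , _ , N))) }
      where
      cubic : ∀ {v w} → Adj v w → Three G w → w ∈ filter (λ w → adj? v w ×-dec (deg G w ℕ.≟ 3)) (allFin n)
      cubic {v} a t = ∈-filter⁺ (λ w → adj? v w ×-dec (deg G w ℕ.≟ 3)) (∈-allFin _) (a , three-deg t)
      adjacent : ∀ {v a b c} → N₃ G v a b c → Adj a b ⊎ Adj a c ⊎ Adj b c
      adjacent {v} N with proj₁ girth v (three-deg (_ , _ , _ , N))
      ... | k , (cyc , _) , k≤3 with short-cycle cyc k≤3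
      ...   | p , q , vp , vq , pq with cover₃ N vp | cover₃ N vq
      ...     | inj₁ refl | inj₁ refl = ⊥-elim (irrefl pq)
      ...     | inj₁ refl | inj₂ (inj₁ refl) = inj₁ pq
      ...     | inj₁ refl | inj₂ (inj₂ refl) = inj₂ (inj₁ pq)
      ...     | inj₂ (inj₁ refl) | inj₁ refl = inj₁ (symm pq)
      ...     | inj₂ (inj₁ refl) | inj₂ (inj₁ refl) = ⊥-elim (irrefl pq)
      ...     | inj₂ (inj₁ refl) | inj₂ (inj₂ refl) = inj₂ (inj₂ pq)
      ...     | inj₂ (inj₂ refl) | inj₁ refl = inj₂ (inj₁ (symm pq))
      ...     | inj₂ (inj₂ refl) | inj₂ (inj₁ refl) = inj₂ (inj₂ (symm pq))
      ...     | inj₂ (inj₂ refl) | inj₂ (inj₂ refl) = ⊥-elim (irrefl pq)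

  radius≤2 : ∀ (k : Colour) → Vec.lookup (1 ∷ 2 ∷ 2 ∷ 2 ∷ []) k ≤ 2
  radius≤2 0F = s≤s z≤n
  radius≤2 1F = s≤s (s≤s z≤n)
  radius≤2 2F = s≤s (s≤s z≤n)
  radius≤2 3F = s≤s (s≤s z≤n)

  -- Distances 0 and 1 are contradictory, distance 2 forces colour 0, of radius 1, and anything
  -- longer exceeds every radius.
  valid⇒packing : ∀ {G : Graph n} {f} → Valid G f → ∀ u v → u ≢ v → f u ≡ f v →
    DistGt G u v (Vec.lookup (1 ∷ 2 ∷ 2 ∷ 2 ∷ []) (f u))
  valid⇒packing V u .u u≢u _ _ (here , _) = ⊥-elim (u≢u refl)
  valid⇒packing V u v _ e _ (step a here , _) = ⊥-elim (Valid.proper V a e)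
  valid⇒packing {G} {f} V u v u≢v e _ (step a (step b here) , _) =
    subst (λ k → Vec.lookup (1 ∷ 2 ∷ 2 ∷ 2 ∷ []) k < 2)
      (sym (Valid.apart V (Graph.sym G a) b u≢v e)) (s≤s (s≤s z≤n))
  valid⇒packing {f = f} V u _ _ _ _ (step _ (step _ (step _ _)) , _) =
    s≤s (≤-trans (radius≤2 (f u)) (s≤s (s≤s z≤n)))

theorem4 : ∀ {n : ℕ} (G : Graph n) → Subcubic G → Saturated G 2 → G3 G 3 →
    PackingColorable G (1 ∷ 2 ∷ 2 ∷ 2 ∷ [])
theorem4 G subcubic saturated girth =
  let f , V = valid-colouring G (class G subcubic saturated girth) in f , valid⇒packing V
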